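{- For every integer $m\geq 3$ with $m\neq 6$, let $k=k(m)$ be the unique integer such that $2^k+2^{k-1}\leq m<2^k+2^{k+1}$. Then $$H_{2}(m,2)=H_{2}(2^k,2)\,2^{m-2^k}+H_{2}(m-2^k,2)\,2^{2^k}+2^k(m-2^k).$$ For $m=6$, $H_2(6,2)=2\cdot H_2(3,2)\cdot 2^{3}+9$. Consequently, $$\lim_{m\to\infty}\frac{H_{2}(m,2)}{m2^{m-1}}=\sum_{j=1}^{\infty}\frac{2^{j-1}}{2^{2^j}}.$$
   Context: A triangular choice multigraph (TCM) $\mathcal{G}$ on a vertex set $V$ is obtained by choosing, for every 3-element subset $\{u,v,w\}\subseteq V$, exactly one of the pairs $uv,uw,vw$ and adding one copy of it as an edge; $m^{\mathcal{G}}_{xy}$ is the multiplicity of the pair $xy$, and for a TCM on $[m]$, $w(\mathcal{G},2)=\sum_{xy\in\binom{[m]}{2}}2^{m^{\mathcal{G}}_{xy}}$. A TCM $\mathcal{G}$ on $V$ is 2-recursive if either $|V|\in\{1,2\}$ and $\mathcal{G}$ is empty, or $|V|\geq 3$ and there is a partition $V=V_1\cup V_2$ with $V_1,V_2\neq\emptyset$ such that $\mathcal{G}=\mathcal{G}_1\cup\mathcal{G}_2\cup\mathcal{G}_3$ (union with multiplicities), where $\mathcal{G}_i$ is a 2-recursive TCM on $V_i$ and $\mathcal{G}_3$ consists of: for every triple with $u,v\in V_1$, $w\in V_2$ a copy of $uv$, and for every triple with $u\in V_1$, $v,w\in V_2$ a copy of $vw$. $H_2(m,2)$ is the maximum of $w(\mathcal{G},2)$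 over all 2-recursive TCMs on $[m]$. -}

module Defs where

open import Data.Nat as ℕ using (ℕ; zero; suc; _+_; _*_; _∸_; _^_; _≤_; _<ᵇ_; _≡ᵇ_)
open import Data.Nat.Properties using (m^n≢0; m*n≢0)
open import Data.Bool using (Bool; true; false; if_then_else_; _∧_; not)
open import Data.Fin using (Fin; toℕ)
open import Data.Fin.Subset using (Subset; ⊤; _∪_; Empty; ∣_∣)
open import Data.Vec using (lookup)
open import Data.Product using (Σ; _×_; ∃)
open import Data.Sum using (_⊎_)
open import Data.Integer using (+_)
open import Data.Rational using (ℚ; _/_; 0ℚ) renaming (_+_ to _+ℚ_)
open import Relation.Binary.PropositionalEquality using (_≡_)
open import Relation.Nullary using (¬_)

-- A multigraph on (a subset of) the vertex set [m] = Fin m, given by its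
-- multiplicity function: mult x y = multiplicity of the pair xy.
Mult : ℕ → Set
Mult m = Fin m → Fin m → ℕ

_∈ᵇ_ : ∀ {m} → Fin m → Subset m → Bool
x ∈ᵇ V = lookup V x

-- The multigraph G₃ of the recursive construction for the partition V = V₁ ∪ V₂:
-- each pair uv inside V₁ gets one copy per w ∈ V₂ (i.e. |V₂| copies), and each
-- pair vw inside V₂ gets one copy per u ∈ V₁ (i.e. |V₁| copies); all other pairs 0.
G₃ : ∀ {m} → Subset m → Subset m → Mult m
G₃ V₁ V₂ x y =
  if not (toℕ x ≡ᵇ toℕ y) ∧ (x ∈ᵇ V₁) ∧ (y ∈ᵇ V₁) then ∣ V₂ ∣
  else (if not (toℕ x ≡ᵇ toℕ y) ∧ (x ∈ᵇ V₂) ∧ (y ∈ᵇ V₂) then ∣ V₁ ∣ else 0)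

_⊕_ : ∀ {m} → Mult m → Mult m → Mult m
(g ⊕ h) x y = g x y + h x y

Disjoint : ∀ {m} → Subset m → Subset m → Set
Disjoint {m} V₁ V₂ = (x : Fin m) → x ∈ᵇ V₁ ∧ x ∈ᵇ V₂ ≡ false

data Rec2 {m : ℕ} : Subset m → Mult m → Set where
  small : ∀ {V} → (∣ V ∣ ≡ 1 ⊎ ∣ V ∣ ≡ 2) → Rec2 V (λ _ _ → 0)
  split : ∀ {V V₁ V₂ g₁ g₂} →
          3 ≤ ∣ V ∣ → V₁ ∪ V₂ ≡ V → Disjoint V₁ V₂ →
          ¬ Empty V₁ → ¬ Empty V₂ →
          Rec2 V₁ g₁ → Rec2 V₂ g₂ →
          Rec2 V ((g₁ ⊕ g₂) ⊕ G₃ V₁ V₂)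

sumFin : (n : ℕ) → (Fin n → ℕ) → ℕ
sumFin zero    f = 0
sumFin (suc n) f = f Fin.zero + sumFin n (λ i → f (Fin.suc i))

weight : (m : ℕ) → Mult m → ℕ
weight m g = sumFin m (λ x → sumFin m (λ y →
  if toℕ x <ᵇ toℕ y then 2 ^ g x y else 0))

IsH2 : ℕ → ℕ → Set
IsH2 m h = (Σ (Mult m) λ g → Rec2 ⊤ g × weight m g ≡ h)
         × ((g : Mult m) → Rec2 ⊤ g → weight m g ≤ h)

-- h / (m 2^{m-1}) as a rational (m = 0 mapped to 0, never used)
ratio : ℕ → ℕ → ℚ
ratio h zero    = 0ℚ
ratio h (suc n) = (+ h) / (suc n * 2 ^ n)
  where instance _ = m*n≢0 (suc n) (2 ^ n) {{_}} {{m^n≢0 2 n}}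

S : ℕ → ℚ
S zero    = 0ℚ
S (suc j) = S j +ℚ ((+ (2 ^ j)) / (2 ^ (2 ^ suc j)))
  where instance _ = m^n≢0 2 (2 ^ suc j)

{-# OPTIONS --safe #-}
-- Cutting a vertex set into parts of sizes a and b gives weight H a * 2^b + H b * 2^a + a * b, so H is governed
-- by the best cut. With F n = H n / 2^n and φ a b = a * b / 2^(a + b), the cut (a, b) contributes
-- F a + F b + φ a b. Let H be defined by always cutting off the power of two h = 2^k of the window (except at 6);
-- then optimality is the superadditivity F a + F b + φ a b ≤ F (a + b). Writing a + b = h + c, it compares
-- F a + F b + φ a b with F h + F c + φ h c. Replacing a, b, h, c by their own cuts reduces the comparison to one
-- with h / 2 in place of h plus an inequality between values of φ. Such inequalities hold because n / 2^n
-- decreases fast, and since the error terms are doubly exponentially small, the induction closes from h = 8,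
-- where finitely many cases are computed.
-- The limit only uses superadditivity: t F x ≤ F n for t x ≤ n, once with x a power of two and once with n one,
-- together with 2 F (2^k) = 2^k S k.
module Submission where

open import Defs
open import Data.Bool using (Bool; true; false; if_then_else_; _∧_; _∨_; not; T)
open import Data.Empty using (⊥-elim)
open import Data.Fin using (Fin; toℕ)
open import Data.Fin.Subset using (Subset; ⊤; _∪_; Empty)
import Data.Fin.Subset as Subset
open import Data.Fin.Subset.Properties using (Empty-unique; ∣⊥∣≡0; ∣⊤∣≡n; x∈p⇒∣p-x∣<∣p∣)
open import Data.Integer using (+_; +≤+; drop‿+≤+)
import Data.Integer as ℤ
import Data.Integer.Properties as ℤₚ
open import Data.List using (_∷_; [])
open import Data.Nat using (ℕ; zero; suc; _+_; _*_; _∸_; _^_; _≤_; _<_; _≡ᵇ_; _<ᵇ_; NonZero; >-nonZero; z≤n; s≤s)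
open import Data.Nat.DivMod using (_%_; m≡m%n+[m/n]*n; m%n<n; m/n*n≤m) renaming (_/_ to _div_)
open import Data.Nat.Induction using (<-rec)
open import Data.Nat.Properties
open import Data.Nat.Tactic.RingSolver using (solve; solve-∀)
open import Data.Product using (Σ; ∃; _×_; _,_; proj₁; proj₂)
open import Data.Rational using (ℚ; _/_; ∣_∣; _-_; 0ℚ; toℚᵘ; Positive; positive; nonNegative)
  renaming (_<_ to _<ℚ_; _≤_ to _≤ℚ_; _+_ to _+ℚ_; _*_ to _*ℚ_; -_ to -ℚ_)
import Data.Rational.Properties as ℚₚ
import Data.Rational.Unnormalised as ℚᵘ
import Data.Rational.Unnormalised.Properties as ℚᵘₚ
open import Data.Sum using (_⊎_; inj₁; inj₂)
open import Data.Vec using () renaming ([] to []ᵛ; _∷_ to _∷ᵛ_)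
open import Data.Vec.Properties using (lookup-zipWith; lookup-replicate)
open import Function using (_∘_)
open import Level using (0ℓ)
open import Relation.Binary.Definitions using (tri<; tri≈; tri>)
open import Relation.Binary.PropositionalEquality
open import Relation.Nullary using (¬_; Dec; yes; no)
open import Relation.Nullary.Decidable using (dec⇒maybe; toWitness; _×-dec_; _→-dec_)
import Tactic.RingSolver as RS
open import Tactic.RingSolver.Core.AlmostCommutativeRing using (AlmostCommutativeRing; fromCommutativeRing)

-- Fractions with denominator a power of two

-- Two inductions are nested. The outer one runs on the sum a + b and supplies superadditivity for
-- smaller sums. Inside it, with that hypothesis fixed, the inner one doubles q and proves
-- `Claims N q`. Optimality of the cut alone does not survive the doubling: once a, b and h have
-- been cut in turn, values of φ remain that the smaller comparison has to pay for. Hence the claims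
-- are strengthened by surpluses, each chosen so that it both covers these values and is reproduced
-- one level up. The number 6 shows why the start is at h = 8. Since F 3 + F 3 = 1 = F 4 + F 2, the
-- comparison of (3, 3) with (4, 2) has no surplus, and φ 3 3 = 9/64 against φ 4 2 = 8/64 decides
-- for the cut in halves. So `below` is false for h = 4, while from h = 8 on its surplus 2 / 2^h
-- exceeds every φ a b that it meets or equals it.

ℚ-ring : AlmostCommutativeRing 0ℓ 0ℓ
ℚ-ring = fromCommutativeRing ℚₚ.+-*-commutativeRing (λ x → dec⇒maybe (0ℚ ℚₚ.≟ x))

toℚᵘ-/ : ∀ x d → toℚᵘ (+ x / suc d) ℚᵘ.≃ ℚᵘ.mkℚᵘ (+ x) d
toℚᵘ-/ x d = ℚₚ.toℚᵘ-fromℚᵘ (ℚᵘ.mkℚᵘ (+ x) d)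

/-mono-≤ : ∀ x y d e .{{_ : NonZero d}} .{{_ : NonZero e}} → x * e ≤ y * d → (+ x / d) ≤ℚ (+ y / e)
/-mono-≤ x y (suc d) (suc e) xe≤yd = ℚₚ.toℚᵘ-cancel-≤
  (ℚᵘₚ.≤-respˡ-≃ (ℚᵘₚ.≃-sym (toℚᵘ-/ x d)) (ℚᵘₚ.≤-respʳ-≃ (ℚᵘₚ.≃-sym (toℚᵘ-/ y e))
    (ℚᵘ.*≤* (subst₂ ℤ._≤_ (ℤₚ.pos-* x (suc e)) (ℤₚ.pos-* y (suc d)) (+≤+ xe≤yd)))))

/-cancel-≤ : ∀ x y d e .{{_ : NonZero d}} .{{_ : NonZero e}} → (+ x / d) ≤ℚ (+ y / e) → x * e ≤ y * d
/-cancel-≤ x y (suc d) (suc e) p with ℚᵘₚ.≤-respˡ-≃ (toℚᵘ-/ x d) (ℚᵘₚ.≤-respʳ-≃ (toℚᵘ-/ y e) (ℚₚ.toℚᵘ-mono-≤ p))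
... | ℚᵘ.*≤* q = drop‿+≤+ (subst₂ ℤ._≤_ (sym (ℤₚ.pos-* x (suc e))) (sym (ℤₚ.pos-* y (suc d))) q)

/-≡ : ∀ x y d e .{{_ : NonZero d}} .{{_ : NonZero e}} → x * e ≡ y * d → (+ x / d) ≡ (+ y / e)
/-≡ x y d e eq = ℚₚ.≤-antisym (/-mono-≤ x y d e (≤-reflexive eq)) (/-mono-≤ y x e d (≤-reflexive (sym eq)))

/-+ : ∀ x y d .{{_ : NonZero d}} → (+ x / d) +ℚ (+ y / d) ≡ (+ (x + y) / d)
/-+ x y (suc d) = ℚₚ.toℚᵘ-injective (ℚᵘₚ.≃-trans (ℚₚ.toℚᵘ-homo-+ (+ x / suc d) (+ y / suc d))
  (ℚᵘₚ.≃-trans (ℚᵘₚ.+-cong (toℚᵘ-/ x d) (toℚᵘ-/ y d)) (ℚᵘₚ.≃-trans (ℚᵘ.*≡* eq) (ℚᵘₚ.≃-sym (toℚᵘ-/ (x + y) d)))))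
  where
  D = + suc d
  eq : (+ x ℤ.* D ℤ.+ + y ℤ.* D) ℤ.* D ≡ + (x + y) ℤ.* (+ (suc d * suc d))
  eq = trans (cong (ℤ._* D) (sym (ℤₚ.*-distribʳ-+ D (+ x) (+ y))))
       (trans (ℤₚ.*-assoc (+ (x + y)) D D) (cong (+ (x + y) ℤ.*_) (sym (ℤₚ.pos-* (suc d) (suc d)))))

/-*ˡ : ∀ c x d .{{_ : NonZero d}} → (+ c / 1) *ℚ (+ x / d) ≡ (+ (c * x) / d)
/-*ˡ c x (suc d) = ℚₚ.toℚᵘ-injective (ℚᵘₚ.≃-trans (ℚₚ.toℚᵘ-homo-* (+ c / 1) (+ x / suc d))
  (ℚᵘₚ.≃-trans (ℚᵘₚ.*-cong (toℚᵘ-/ c 0) (toℚᵘ-/ x d)) (ℚᵘₚ.≃-trans (ℚᵘ.*≡* eq) (ℚᵘₚ.≃-sym (toℚᵘ-/ (c * x) d)))))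
  where
  eq : + c ℤ.* + x ℤ.* + suc d ≡ + (c * x) ℤ.* + (1 * suc d)
  eq = cong₂ (λ s t → s ℤ.* + t) (sym (ℤₚ.pos-* c x)) (sym (+-identityʳ (suc d)))

/-mono-< : ∀ x y d e .{{_ : NonZero d}} .{{_ : NonZero e}} → x * e < y * d → (+ x / d) <ℚ (+ y / e)
/-mono-< x y d e lt = ℚₚ.≰⇒> (λ p → <⇒≱ lt (/-cancel-≤ y x e d p))

-- Opaque because unification would otherwise unfold the reduction to lowest terms.
infixl 7 _/2^_
opaque
  _/2^_ : ℕ → ℕ → ℚ
  x /2^ n = _/_ (+ x) (2 ^ n) {{m^n≢0 2 n}}

  /2^-/ : ∀ x n → x /2^ n ≡ _/_ (+ x) (2 ^ n) {{m^n≢0 2 n}}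
  /2^-/ x n = refl

  /2^-nonneg : ∀ x n → 0ℚ ≤ℚ x /2^ n
  /2^-nonneg x n = /-mono-≤ 0 x 1 (2 ^ n) {{_}} {{m^n≢0 2 n}} z≤n

  /2^-mono : ∀ {x y} n → x ≤ y → x /2^ n ≤ℚ y /2^ n
  /2^-mono {x} {y} n x≤y = /-mono-≤ x y (2 ^ n) (2 ^ n) {{m^n≢0 2 n}} {{m^n≢0 2 n}} (*-monoˡ-≤ (2 ^ n) x≤y)

  /2^-cancel : ∀ {x y} n → x /2^ n ≤ℚ y /2^ n → x ≤ y
  /2^-cancel {x} {y} n p = *-cancelʳ-≤ x y (2 ^ n) {{m^n≢0 2 n}} (/-cancel-≤ x y (2 ^ n) (2 ^ n) {{m^n≢0 2 n}} {{m^n≢0 2 n}} p)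

  /2^-+ : ∀ x y n → x /2^ n +ℚ y /2^ n ≡ (x + y) /2^ n
  /2^-+ x y n = /-+ x y (2 ^ n) {{m^n≢0 2 n}}

  /2^0-* : ∀ c x d .{{_ : NonZero d}} → (c /2^ 0) *ℚ (+ x / d) ≡ (+ (c * x) / d)
  /2^0-* = /-*ˡ

  /2^0-*/2^ : ∀ c x n → (c /2^ 0) *ℚ (x /2^ n) ≡ (c * x) /2^ n
  /2^0-*/2^ c x n = /-*ˡ c x (2 ^ n) {{m^n≢0 2 n}}

  0/2^ : ∀ n → 0 /2^ n ≡ 0ℚ
  0/2^ n = /-≡ 0 0 (2 ^ n) 1 {{m^n≢0 2 n}} refl

  /2^0≤/ : ∀ c x d .{{_ : NonZero d}} → c * d ≤ x → c /2^ 0 ≤ℚ (+ x / d)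
  /2^0≤/ c x d cd≤x = /-mono-≤ c x 1 d (≤-trans cd≤x (≤-reflexive (sym (*-identityʳ x))))

  /2^0-positive : ∀ {c} → 1 ≤ c → Positive (c /2^ 0)
  /2^0-positive {c} 1≤c = positive (/-mono-< 0 c 1 1 (≤-trans 1≤c (≤-reflexive (sym (*-identityʳ c)))))

  /2^-shift : ∀ x n d {N} → n + d ≡ N → x /2^ n ≡ (x * 2 ^ d) /2^ N
  /2^-shift x n d refl = /-≡ x (x * 2 ^ d) (2 ^ n) (2 ^ (n + d)) {{m^n≢0 2 n}} {{m^n≢0 2 (n + d)}} (begin
    x * 2 ^ (n + d)        ≡⟨ cong (x *_) (trans (^-distribˡ-+-* 2 n d) (*-comm (2 ^ n) (2 ^ d))) ⟩
    x * (2 ^ d * 2 ^ n)    ≡⟨ *-assoc x (2 ^ d) (2 ^ n) ⟨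
    x * 2 ^ d * 2 ^ n      ∎)
    where open ≡-Reasoning

-- Linear arithmetic by certificate: l ≤ r adds up the hypotheses, and the equation is left to a ring solver.
linℚ : ∀ {L R l r} → l ≤ℚ r → L +ℚ r ≡ R +ℚ l → L ≤ℚ R
linℚ {L} {R} {l} {r} l≤r eq = ℚₚ.≤-trans (ℚₚ.≤-reflexive (e L l))
  (ℚₚ.≤-trans (ℚₚ.+-monoˡ-≤ (-ℚ l) (ℚₚ.≤-trans (ℚₚ.+-monoʳ-≤ L l≤r) (ℚₚ.≤-reflexive eq))) (ℚₚ.≤-reflexive (sym (e R l))))
  where
  e : ∀ x y → x ≡ x +ℚ y +ℚ (-ℚ y)
  e = RS.solve-∀ ℚ-ring

-- Over ℕ the surplus `d` of the right side is part of the certificate, so that an equation remains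
-- to be checked.
linℕ : ∀ {L R l r} d → l ≤ r → L + r + d ≡ R + l → L ≤ R
linℕ {L} {R} {l} {r} d l≤r eq = +-cancelʳ-≤ r L R (≤-trans (m≤m+n _ d) (≤-trans (≤-reflexive eq) (+-monoʳ-≤ R l≤r)))

linℕ-≡ : ∀ {L R l r} → l ≡ r → L + r ≡ R + l → L ≡ R
linℕ-≡ {L} {R} {l} {r} l≡r eq = +-cancelʳ-≡ r L R (trans eq (cong (λ x → R + x) l≡r))

infixl 6 _⊞_
-- Collects summands that have been brought to a common denominator; `≤-via-/2^` then leaves a
-- comparison of numerators.
_⊞_ : ∀ {P Q x y n} → P ≡ x /2^ n → Q ≡ y /2^ n → P +ℚ Q ≡ (x + y) /2^ n
_⊞_ {x = x} {y} {n} refl refl = /2^-+ x y n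

≤-via-/2^ : ∀ {P Q x y} n → P ≡ x /2^ n → Q ≡ y /2^ n → x ≤ y → P ≤ℚ Q
≤-via-/2^ n refl refl x≤y = /2^-mono n x≤y

n<2^n : ∀ n → suc n ≤ 2 ^ n
n<2^n zero = ≤-refl
n<2^n (suc n) = linℕ n (+-mono-≤ (n<2^n n) (n<2^n n)) (eq n (2 ^ n))
  where
  eq : ∀ n x → suc (suc n) + (x + x) + n ≡ 2 * x + (suc n + suc n)
  eq = solve-∀

2^n+2^n≡2^[1+n] : ∀ n → 2 ^ n + 2 ^ n ≡ 2 ^ suc n
2^n+2^n≡2^[1+n] n = cong (λ x → 2 ^ n + x) (sym (+-identityʳ (2 ^ n)))

n[1+n]≤2*2^n : ∀ n → n * suc n ≤ 2 * 2 ^ n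
n[1+n]≤2*2^n zero = z≤n
n[1+n]≤2*2^n (suc n) = linℕ 0 (+-mono-≤ (n[1+n]≤2*2^n n) (*-monoʳ-≤ 2 (n<2^n n))) (eq n (2 ^ n))
  where
  eq : ∀ n x → suc n * suc (suc n) + (2 * x + 2 * x) + 0 ≡ 2 * (2 * x) + (n * suc n + 2 * suc n)
  eq = solve-∀

-- Fails for n = 4, whence the hypothesis 8 ≤ q wherever values of φ are bounded with it.
2n²≤2^n : ∀ {n} → 8 ≤ n → 2 * (n * n) ≤ 2 ^ n
2n²≤2^n {n} 8≤n with m≤n⇒∃[o]m+o≡n 8≤n
... | d , refl = go d
  where
  go : ∀ d → 2 * ((8 + d) * (8 + d)) ≤ 2 ^ (8 + d)
  go zero = ≤ᵇ⇒≤ 128 256 _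
  go (suc d) = linℕ (94 + 28 * d + 2 * (d * d)) (*-monoʳ-≤ 2 (go d)) (eq (2 ^ (8 + d)) d)
    where
    eq : ∀ x d → 2 * ((9 + d) * (9 + d)) + 2 * x + (94 + 28 * d + 2 * (d * d)) ≡ 2 * x + 2 * (2 * ((8 + d) * (8 + d)))
    eq = solve-∀

3n≤2^n : ∀ {n} → 4 ≤ n → 3 * n ≤ 2 ^ n
3n≤2^n {n} 4≤n with m≤n⇒∃[o]m+o≡n 4≤n
... | d , refl = go d
  where
  go : ∀ d → 3 * (4 + d) ≤ 2 ^ (4 + d)
  go zero = ≤ᵇ⇒≤ 12 16 _
  go (suc d) = linℕ (9 + 3 * d) (*-monoʳ-≤ 2 (go d)) (eq (2 ^ (4 + d)) d)
    where
    eq : ∀ x d → 3 * (5 + d) + 2 * x + (9 + 3 * d) ≡ 2 * x + 2 * (3 * (4 + d))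
    eq = solve-∀

-- Inequalities between values of φ

φ : ℕ → ℕ → ℚ
φ a b = (a * b) /2^ (a + b)

φ-comm : ∀ a b → φ a b ≡ φ b a
φ-comm a b = cong₂ _/2^_ (*-comm a b) (+-comm a b)

-- n / 2^n decreases from n = 1 on, because z + d ≤ z * 2^d for z ≥ 1. At 0 it vanishes, so z = 0
-- has to be excluded.
φ-antitone : ∀ x {y z} → 1 ≤ z → z ≤ y → φ x y ≤ℚ φ x z
φ-antitone x {y} {suc z} _ z≤y with m≤n⇒∃[o]m+o≡n z≤y
... | d , refl = ≤-via-/2^ (x + suc (z + d)) refl (/2^-shift (x * suc z) (x + suc z) d (+-assoc x (suc z) d))
  (≤-trans (*-monoʳ-≤ x (≤-trans (linℕ (z * d) ≤-refl (eq z d)) (*-monoʳ-≤ (suc z) (n<2^n d)))) (≤-reflexive (sym (*-assoc x (suc z) (2 ^ d)))))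
  where
  eq : ∀ z d → suc z + d + 0 + z * d ≡ suc z * suc d + 0
  eq = solve-∀

-- For a fixed sum a product grows as its factors approach each other. Here h and c both lie between
-- a and b; in `φ-cut-≤-φ` they are the outer pair.
φ-≤-φ-cut : ∀ {a b h c} → a ≤ h → h ≤ b → a + b ≡ h + c → φ a b ≤ℚ φ h c
φ-≤-φ-cut {a} {b} {h} {c} a≤h h≤b eq with m≤n⇒∃[o]m+o≡n a≤h | m≤n⇒∃[o]m+o≡n h≤b
... | s , refl | t , refl with +-cancelˡ-≡ (a + s) c (a + t) (trans (sym eq) (solve (a ∷ s ∷ t ∷ [])))
... | refl = ≤-via-/2^ (a + s + (a + t)) (cong ((a * (a + s + t)) /2^_) eq) refl (linℕ (s * t) (≤-refl {0}) (solve (a ∷ s ∷ t ∷ [])))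

φ-cut-≤-φ : ∀ {a b h c} → h ≤ a → h ≤ b → a + b ≡ h + c → φ h c ≤ℚ φ a b
φ-cut-≤-φ {a} {b} {h} {c} h≤a h≤b eq with m≤n⇒∃[o]m+o≡n h≤a | m≤n⇒∃[o]m+o≡n h≤b
... | s , refl | t , refl with +-cancelˡ-≡ h c (h + s + t) (trans (sym eq) (solve (h ∷ s ∷ t ∷ [])))
... | refl = ≤-via-/2^ (h + (h + s + t)) refl (cong (((h + s) * (h + t)) /2^_) eq) (linℕ (s * t) (≤-refl {0}) (solve (h ∷ s ∷ t ∷ [])))

-- Since φ a b = g a * g b for g n = n / 2^n, this is (g a - g q) (g b - g q) ≥ 2 / 2^2q multiplied out.
φ-exchange-below : ∀ {q a b} → 4 ≤ a → 4 ≤ b → a < q → b < q →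
  φ q a +ℚ φ q b +ℚ 2 /2^ (q + q) ≤ℚ φ q q +ℚ φ a b
φ-exchange-below {q} {a} {b} 4≤a 4≤b a<q b<q with m≤n⇒∃[o]m+o≡n a<q | m≤n⇒∃[o]m+o≡n b<q
... | s , a+s | t , b+t with m≤n⇒∃[o]m+o≡n (excess 4≤a a+s) | m≤n⇒∃[o]m+o≡n (excess 4≤b b+t)
  where
  excess : ∀ {a s} → 4 ≤ a → suc a + s ≡ q → q + 2 ≤ a * 2 ^ suc s
  excess {a} {s} 4≤a refl with m≤n⇒∃[o]m+o≡n 4≤a
  ... | d , refl = ≤-trans (linℕ (s * 3 + d + d * s + 1) (≤-refl {0}) (eq d s)) (*-monoʳ-≤ (4 + d) (n<2^n (suc s)))
    where
    eq : ∀ d s → suc (4 + d) + s + 2 + 0 + (s * 3 + d + d * s + 1) ≡ (4 + d) * suc (suc s) + 0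
    eq = solve-∀
... | A₀ , A≡ | B₀ , B≡ = ≤-via-/2^ (q + q)
  (/2^-shift (q * a) (q + a) (suc s) (trans (+-assoc q a (suc s)) (cong (λ z → q + z) a+s′))
    ⊞ /2^-shift (q * b) (q + b) (suc t) (trans (+-assoc q b (suc t)) (cong (λ z → q + z) b+t′)) ⊞ refl)
  (refl ⊞ /2^-shift (a * b) (a + b) (suc s + suc t) (trans (eq₀ a b (suc s) (suc t)) (cong₂ _+_ a+s′ b+t′)))
  (begin
    q * a * 2 ^ suc s + q * b * 2 ^ suc t + 2              ≡⟨ cong₂ (λ x y → x + y + 2) (*-assoc q a _) (*-assoc q b _) ⟩
    q * (a * 2 ^ suc s) + q * (b * 2 ^ suc t) + 2          ≡⟨ cong₂ (λ x y → q * x + q * y + 2) (sym A≡) (sym B≡) ⟩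
    q * (q + 2 + A₀) + q * (q + 2 + B₀) + 2                ≤⟨ linℕ (2 + 2 * A₀ + 2 * B₀ + A₀ * B₀) (≤-refl {0}) (eq₁ q A₀ B₀) ⟩
    q * q + (q + 2 + A₀) * (q + 2 + B₀)                    ≡⟨ cong₂ (λ x y → q * q + x * y) A≡ B≡ ⟩
    q * q + a * 2 ^ suc s * (b * 2 ^ suc t)                ≡⟨ cong (λ z → q * q + z) (eq₂ a b (2 ^ suc s) (2 ^ suc t)) ⟩
    q * q + a * b * (2 ^ suc s * 2 ^ suc t)                ≡⟨ cong (λ x → q * q + a * b * x) (^-distribˡ-+-* 2 (suc s) (suc t)) ⟨
    q * q + a * b * 2 ^ (suc s + suc t)                    ∎)
  where
  open ≤-Reasoning
  a+s′ : a + suc s ≡ q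
  a+s′ = trans (+-suc a s) a+s
  b+t′ : b + suc t ≡ q
  b+t′ = trans (+-suc b t) b+t
  eq₀ : ∀ a b s t → a + b + (s + t) ≡ a + s + (b + t)
  eq₀ = solve-∀
  eq₁ : ∀ q A B → q * (q + 2 + A) + q * (q + 2 + B) + 2 + 0 + (2 + 2 * A + 2 * B + A * B) ≡ q * q + (q + 2 + A) * (q + 2 + B) + 0
  eq₁ = solve-∀
  eq₂ : ∀ a b x y → a * x * (b * y) ≡ a * b * (x * y)
  eq₂ = solve-∀

-- In terms of g n = n / 2^n this is (g q - g (q + s)) (g q - g (q + t)) ≥ 1 / 2^2q. Each factor is
-- at least 1 / 2^q, which is what `excess` says after clearing denominators.
φ-exchange-above : ∀ {q s t} → 4 ≤ q → 1 ≤ s → 1 ≤ t →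
  φ q (q + s) +ℚ φ q (q + t) +ℚ 1 /2^ (q + q) ≤ℚ φ q q +ℚ φ (q + s) (q + t)
φ-exchange-above {q} {s} {t} 4≤q 1≤s 1≤t with m≤n⇒∃[o]m+o≡n (excess 4≤q 1≤s) | m≤n⇒∃[o]m+o≡n (excess 4≤q 1≤t)
  where
  excess : ∀ {q s} → 4 ≤ q → 1 ≤ s → q + s + 2 ^ s ≤ q * 2 ^ s
  excess {q} {suc s} 4≤q _ with m≤n⇒∃[o]m+o≡n 4≤q
  ... | d , refl = linℕ (1 + d * s + 2 * s + d) (*-monoʳ-≤ (3 + d) (n<2^n (suc s))) (eq d s (2 ^ suc s))
    where
    eq : ∀ d s x → 4 + d + suc s + x + (3 + d) * x + (1 + d * s + 2 * s + d) ≡ (4 + d) * x + (3 + d) * suc (suc s)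
    eq = solve-∀
... | A₀ , A≡ | B₀ , B≡ = ≤-via-/2^ (q + s + (q + t))
  (/2^-shift (q * (q + s)) (q + (q + s)) t (eq₀ q s t)
    ⊞ /2^-shift (q * (q + t)) (q + (q + t)) s (eq₀′ q s t) ⊞ /2^-shift 1 (q + q) (s + t) (eq₀″ q s t))
  (/2^-shift (q * q) (q + q) (s + t) (eq₀″ q s t) ⊞ refl)
  (begin
    q * (q + s) * Y + q * (q + t) * X + 1 * 2 ^ (s + t)  ≡⟨ cong₂ _+_ (eq₁ q s t X Y) (trans (+-identityʳ _) (^-distribˡ-+-* 2 s t)) ⟩
    (q + s) * (q * Y) + (q + t) * (q * X) + X * Y          ≡⟨ cong₂ (λ x y → (q + s) * y + (q + t) * x + X * Y) (sym A≡) (sym B≡) ⟩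
    (q + s) * (q + t + Y + B₀) + (q + t) * (q + s + X + A₀) + X * Y
      ≤⟨ linℕ (X * B₀ + A₀ * Y + A₀ * B₀) (≤-refl {0}) (eq₂ (q + s) (q + t) X Y A₀ B₀) ⟩
    (q + s + X + A₀) * (q + t + Y + B₀) + (q + s) * (q + t)  ≡⟨ cong₂ (λ x y → x * y + (q + s) * (q + t)) A≡ B≡ ⟩
    q * X * (q * Y) + (q + s) * (q + t)                    ≡⟨ cong (λ z → z + (q + s) * (q + t)) (eq₃ q X Y) ⟩
    q * q * (X * Y) + (q + s) * (q + t)                    ≡⟨ cong (λ x → q * q * x + (q + s) * (q + t)) (^-distribˡ-+-* 2 s t) ⟨
    q * q * 2 ^ (s + t) + (q + s) * (q + t)                ∎)
  where
  open ≤-Reasoning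
  X = 2 ^ s
  Y = 2 ^ t
  eq₀ : ∀ q s t → q + (q + s) + t ≡ q + s + (q + t)
  eq₀ = solve-∀
  eq₀′ : ∀ q s t → q + (q + t) + s ≡ q + s + (q + t)
  eq₀′ = solve-∀
  eq₀″ : ∀ q s t → q + q + (s + t) ≡ q + s + (q + t)
  eq₀″ = solve-∀
  eq₁ : ∀ q s t X Y → q * (q + s) * Y + q * (q + t) * X ≡ (q + s) * (q * Y) + (q + t) * (q * X)
  eq₁ = solve-∀
  eq₂ : ∀ m n X Y A B → m * (n + Y + B) + n * (m + X + A) + X * Y + 0 + (X * B + A * Y + A * B) ≡ (m + X + A) * (n + Y + B) + m * n + 0
  eq₂ = solve-∀
  eq₃ : ∀ q X Y → q * X * (q * Y) ≡ q * q * (X * Y)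
  eq₃ = solve-∀

-- The difference is g q (g q - g (q + s)) with g n = n / 2^n, where the first factor is at least 4
-- / 2^q and the second at least 1 / 2^q.
φ-drop : ∀ {q s} → 4 ≤ q → 1 ≤ s → φ q (q + s) +ℚ 2 /2^ (q + q) ≤ℚ φ q q
φ-drop {q} {suc s} 4≤q _ with m≤n⇒∃[o]m+o≡n 4≤q | m≤n⇒∃[o]m+o≡n (n<2^n (suc s))
... | d , refl | r , X≡ = ≤-via-/2^ (q + (q + suc s)) (refl ⊞ /2^-shift 2 (q + q) (suc s) (+-assoc q q (suc s)))
  (/2^-shift (q * q) (q + q) (suc s) (+-assoc q q (suc s)))
  (subst (λ X → q * (q + suc s) + 2 * X ≤ q * q * X) X≡
     (linℕ (8 + 7 * d + d * d + 10 * s + 7 * (d * s) + d * d * s + 14 * r + 8 * (d * r) + d * d * r) (≤-refl {0}) (eq d s r)))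
  where
  eq : ∀ d s r → (4 + d) * (4 + d + suc s) + 2 * (suc (suc s) + r) + 0 +
    (8 + 7 * d + d * d + 10 * s + 7 * (d * s) + d * d * s + 14 * r + 8 * (d * r) + d * d * r) ≡ (4 + d) * (4 + d) * (suc (suc s) + r) + 0
  eq = solve-∀

-- From 2q + s ≤ 2^(q + s) it follows that n / 2^n ≤ 1 / 2^q for n ≥ 2q, and φ is a product of two
-- such values.
φ-tiny : ∀ {q a b} → 8 ≤ q → q + q ≤ a → q + q ≤ b → φ a b ≤ℚ 1 /2^ (q + q)
φ-tiny {q} {a} {b} 8≤q 2q≤a 2q≤b with m≤n⇒∃[o]m+o≡n 2q≤a | m≤n⇒∃[o]m+o≡n 2q≤b
... | s , refl | t , refl = ≤-via-/2^ (q + q + s + (q + q + t)) refl (/2^-shift 1 (q + q) (q + s + (q + t)) (eq₀ q s t))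
  (≤-trans (*-mono-≤ (bound s) (bound t)) (≤-reflexive (trans (sym (^-distribˡ-+-* 2 (q + s) (q + t))) (sym (+-identityʳ _)))))
  where
  eq₀ : ∀ q s t → q + q + (q + s + (q + t)) ≡ q + q + s + (q + q + t)
  eq₀ = solve-∀
  1≤2^ : ∀ n → 1 ≤ 2 ^ n
  1≤2^ n = ≤-trans (s≤s z≤n) (n<2^n n)
  2q≤2^q : q + q ≤ 2 ^ q
  2q≤2^q = ≤-trans (+-mono-≤ q≤q² (≤-trans q≤q² (m≤m+n (q * q) 0))) (2n²≤2^n 8≤q)
    where
    q≤q² : q ≤ q * q
    q≤q² = m≤m*n q q {{>-nonZero (≤-trans (s≤s z≤n) 8≤q)}}
  bound : ∀ s → q + q + s ≤ 2 ^ (q + s)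
  bound zero = subst₂ _≤_ (sym (+-identityʳ _)) (cong (2 ^_) (sym (+-identityʳ q))) 2q≤2^q
  bound (suc s) = subst₂ _≤_ (sym (+-suc (q + q) s)) (cong (2 ^_) (sym (+-suc q s)))
    (linℕ 0 (+-mono-≤ (1≤2^ (q + s)) (bound s)) (eq (q + q + s) (2 ^ (q + s))))
    where
    eq : ∀ x y → suc x + (y + y) + 0 ≡ 2 * y + (1 + x)
    eq = solve-∀

φ-double-≤ : ∀ {q b} → 8 ≤ q → q ≤ b → φ (q + q) b ≤ℚ 1 /2^ (q + q)
φ-double-≤ {q} {b} 8≤q q≤b = ℚₚ.≤-trans (φ-antitone (q + q) (≤-trans (s≤s z≤n) 8≤q) q≤b)
  (≤-via-/2^ (q + q + q) refl (/2^-shift 1 (q + q) q refl)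
    (≤-trans (≤-reflexive (eq q)) (≤-trans (2n²≤2^n 8≤q) (≤-reflexive (sym (+-identityʳ _))))))
  where
  eq : ∀ q → (q + q) * q ≡ 2 * (q * q)
  eq = solve-∀

-- Origin of the margin in `below`: for parts smaller than h = 2q, `a * b` is at most 4q², hence at
-- most 2 * 2^q and 2 * 2^c, so 2 / 2^h covers the whole of φ a b.
φ-below-≤ : ∀ {q a b c} → 8 ≤ q → a < q + q → b < q + q → a + b ≡ q + q + c → q ≤ c → φ a b ≤ℚ 2 /2^ (q + q)
φ-below-≤ {q} {a} {b} {c} 8≤q a< b< eq q≤c = ≤-via-/2^ (q + q + c) (cong ((a * b) /2^_) eq) (/2^-shift 2 (q + q) c refl)
  (begin
    a * b                ≤⟨ *-mono-≤ (<⇒≤ a<) (<⇒≤ b<) ⟩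
    (q + q) * (q + q)    ≡⟨ solve (q ∷ []) ⟩
    2 * (2 * (q * q))    ≤⟨ *-monoʳ-≤ 2 (2n²≤2^n 8≤q) ⟩
    2 * 2 ^ q            ≤⟨ *-monoʳ-≤ 2 (^-monoʳ-≤ 2 q≤c) ⟩
    2 * 2 ^ c            ∎)
  where open ≤-Reasoning

-- The margin of `below` for q = 2p pays for φ q b. With b = e + 1 and p ≤ e, the numerator q * b is
-- at most 2e(e + 1) ≤ 2 * 2^b, so φ q b ≤ 2 / 2^q. The term with exponent 2q is covered by φ q q.
φ-half-≤ : ∀ {p b} → 4 ≤ p → p < b → b ≤ p + p →
  φ (p + p) b +ℚ 2 /2^ (p + p + (p + p)) ≤ℚ 2 /2^ (p + p) +ℚ φ (p + p) (p + p)
φ-half-≤ {p} {suc e} 4≤p (s≤s p≤e) b≤q with m≤n⇒∃[o]m+o≡n b≤q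
... | d , b+d≡q = ≤-via-/2^ (q + q) (/2^-shift (q * suc e) (q + suc e) d (trans (+-assoc q (suc e) d) (cong (λ z → q + z) b+d≡q)) ⊞ refl)
  (/2^-shift 2 q q refl ⊞ refl)
  (+-mono-≤ (begin
    q * suc e * 2 ^ d                ≤⟨ *-monoˡ-≤ (2 ^ d) (*-monoˡ-≤ (suc e) (+-mono-≤ p≤e p≤e)) ⟩
    (e + e) * suc e * 2 ^ d          ≡⟨ cong (_* 2 ^ d) (eq e) ⟩
    2 * (e * suc e) * 2 ^ d          ≤⟨ *-monoˡ-≤ (2 ^ d) (*-monoʳ-≤ 2 (n[1+n]≤2*2^n e)) ⟩
    2 * 2 ^ suc e * 2 ^ d            ≡⟨ *-assoc 2 (2 ^ suc e) (2 ^ d) ⟩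
    2 * (2 ^ suc e * 2 ^ d)          ≡⟨ cong (2 *_) (^-distribˡ-+-* 2 (suc e) d) ⟨
    2 * 2 ^ (suc e + d)              ≡⟨ cong (λ x → 2 * 2 ^ x) b+d≡q ⟩
    2 * 2 ^ q                        ∎)
   (≤-trans (≤-trans (s≤s (s≤s z≤n)) 4≤p) (≤-trans (m≤m+n p p) (m≤m*n q q {{>-nonZero (≤-trans (s≤s z≤n) (≤-trans 4≤p (m≤m+n p p)))}}))))
  where
  open ≤-Reasoning
  q = p + p
  eq : ∀ e → (e + e) * suc e ≡ 2 * (e * suc e)
  eq = solve-∀

-- Write q = 2p. Lowering b by one raises φ q b by q (b - 2) / 2^(q + b), which is at least 2q /
-- 2^3q because b ≥ 3 and b < 2q. On the other side 3p ≤ 2^p gives φ (2q) a ≤ 2q / 2^3q.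
φ-step : ∀ {p a b c} → 4 ≤ p → p + p + p ≤ a → 2 ≤ c → c < b → b < p + p + (p + p) →
  φ (p + p) b +ℚ φ (p + p + (p + p)) a ≤ℚ φ (p + p) c
φ-step {p} {a} {suc e} {c} 4≤p 3p≤a 2≤c (s≤s c≤e) b<2q with m≤n⇒∃[o]m+o≡n b<2q | m≤n⇒∃[o]m+o≡n (≤-trans 2≤c c≤e)
... | d , b+d | e₀ , refl = ℚₚ.≤-trans (ℚₚ.+-monoʳ-≤ (φ q (suc e)) φ2q≤) (ℚₚ.≤-trans main (φ-antitone q (≤-trans (s≤s z≤n) 2≤c) c≤e))
  where
  q = p + p
  φ2q≤ : φ (q + q) a ≤ℚ (q + q) /2^ (q + q + q)
  φ2q≤ = ℚₚ.≤-trans (φ-antitone (q + q) (≤-trans (s≤s z≤n) (≤-trans 4≤p (m≤n+m p q))) 3p≤a)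
    (≤-via-/2^ (q + q + (q + p)) refl (/2^-shift (q + q) (q + q + q) p (+-assoc (q + q) q p))
      (*-monoʳ-≤ (q + q) (≤-trans (≤-reflexive (eq p)) (3n≤2^n 4≤p))))
    where
    eq : ∀ p → p + p + p ≡ 3 * p
    eq = solve-∀
  expo : q + suc e + suc d ≡ q + q + q
  expo = trans (eq q e d) (trans (cong (λ z → q + z) b+d) (sym (+-assoc q q q)))
    where
    eq : ∀ q e d → q + suc e + suc d ≡ q + (suc (suc e) + d)
    eq = solve-∀
  main : φ q (suc e) +ℚ (q + q) /2^ (q + q + q) ≤ℚ φ q e
  main = ≤-via-/2^ (q + q + q) (/2^-shift (q * suc e) (q + suc e) (suc d) expo ⊞ refl)
    (/2^-shift (q * e) (q + e) (2 + d) (trans (eq q e d) expo))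
    (≤-trans (linℕ (2 * (q * e₀ * 2 ^ d)) (*-monoʳ-≤ (2 * q) (≤-trans (s≤s z≤n) (n<2^n d))) (eq′ q e₀ (2 ^ d)))
      ≤-refl)
    where
    eq : ∀ q e d → q + e + (2 + d) ≡ q + suc e + suc d
    eq = solve-∀
    eq′ : ∀ q e X → q * suc (2 + e) * (2 * X) + (q + q) + 2 * q * X + 2 * (q * e * X) ≡ q * (2 + e) * (2 * (2 * X)) + 2 * q * 1
    eq′ = solve-∀

-- The recursion cutting off powers of two

-- 2^k + 2^(k-1) ≤ n < 2^k + 2^(k+1), without halving, so that n = 2 falls into the window k = 0.
record InWindow (k n : ℕ) : Set where
  constructor window
  field
    lower : 3 * 2 ^ k ≤ 2 * n
    upper : n < 3 * 2 ^ k

windows-disjoint : ∀ {j k n} → j < k → InWindow j n → InWindow k n → ∀ {A : Set} → A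
windows-disjoint {j} {k} {n} j<k (window _ n<) (window ≤2n _) = ⊥-elim (<-irrefl refl (begin-strict
  2 * n              <⟨ *-monoʳ-< 2 n< ⟩
  2 * (3 * 2 ^ j)    ≡⟨ eq (2 ^ j) ⟩
  3 * 2 ^ suc j      ≤⟨ *-monoʳ-≤ 3 (^-monoʳ-≤ 2 j<k) ⟩
  3 * 2 ^ k          ≤⟨ ≤2n ⟩
  2 * n              ∎))
  where
  open ≤-Reasoning
  eq : ∀ x → 2 * (3 * x) ≡ 3 * (2 * x)
  eq = solve-∀

window-unique : ∀ {j k n} → InWindow j n → InWindow k n → j ≡ k
window-unique {j} {k} wj wk with <-cmp j k
... | tri< j<k _ _ = windows-disjoint j<k wj wk
... | tri≈ _ j≡k _ = j≡k
... | tri> _ _ k<j = windows-disjoint k<j wk wj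

suc-if : ∀ {A : Set} → Dec A → ℕ → ℕ
suc-if (yes _) k = suc k
suc-if (no  _) k = k

suc-if-window : ∀ {k n} (d : Dec (3 * 2 ^ k ≤ suc n)) → InWindow k n → InWindow (suc-if d k) (suc n)
suc-if-window {k} {n} (yes ≤sn) (window ≤2n n<) = window (linℕ 0 (*-monoʳ-≤ 2 ≤sn) (eq (2 ^ k) n)) (linℕ n (+-mono-≤ n< n<) (eq′ (2 ^ k) n))
  where
  eq : ∀ x n → 3 * (2 * x) + 2 * suc n + 0 ≡ 2 * suc n + 2 * (3 * x)
  eq = solve-∀
  eq′ : ∀ x n → suc (suc n) + (3 * x + 3 * x) + n ≡ 3 * (2 * x) + (suc n + suc n)
  eq′ = solve-∀
suc-if-window {n = n} (no ≰sn) (window ≤2n n<) = window (≤-trans ≤2n (*-monoʳ-≤ 2 (n≤1+n n))) (≰⇒> ≰sn)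

raise : ℕ → ℕ → ℕ
raise n k = suc-if (3 * 2 ^ k ≤? n) k

-- Computed upwards from 2: the windows are consecutive intervals covering all n ≥ 2, so each
-- successor raises the level by at most one.
level : ℕ → ℕ
level (suc (suc (suc n))) = raise (suc (suc (suc n))) (level (suc (suc n)))
level _ = 0

level-window : ∀ {n} → 2 ≤ n → InWindow (level n) n
level-window {suc zero} (s≤s ())
level-window {suc (suc zero)} _ = window (≤ᵇ⇒≤ 3 4 _) (≤ᵇ⇒≤ 3 3 _)
level-window {suc (suc (suc n))} _ = suc-if-window (3 * 2 ^ level (suc (suc n)) ≤? suc (suc (suc n))) (level-window {suc (suc n)} (s≤s (s≤s z≤n)))

cut : ℕ → ℕ
cut n = if n ≡ᵇ 6 then 3 else 2 ^ level n

cut-bounds : ∀ {n} → 2 ≤ n → 1 ≤ cut n × cut n < n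
cut-bounds {n} 2≤n with n ≡ᵇ 6 in n≡6
... | true = s≤s z≤n , subst (3 <_) (sym (≡ᵇ⇒≡ n 6 (subst T (sym n≡6) _))) (≤ᵇ⇒≤ 4 6 _)
... | false with level-window 2≤n
... | window ≤2n _ = m^n>0 2 (level n) , *-cancelˡ-< 2 _ n (≤-trans (linℕ 0 (m^n>0 2 (level n)) (eq (2 ^ level n))) ≤2n)
  where
  eq : ∀ x → suc (2 * x) + x + 0 ≡ 3 * x + 1
  eq = solve-∀

join : ℕ → ℕ → ℕ → ℕ → ℕ
join x y a b = x * 2 ^ b + y * 2 ^ a + a * b

-- The first argument is fuel, as the two parts of a cut are smaller than n but not structurally so.
-- Fuel n suffices for n, and by `Hᶠ-fuel` any larger amount gives the same value.
Hᶠ : ℕ → ℕ → ℕ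
Hᶠ zero n = 0
Hᶠ (suc f) zero = 0
Hᶠ (suc f) (suc zero) = 0
Hᶠ (suc f) n@(suc (suc _)) = join (Hᶠ f (cut n)) (Hᶠ f (n ∸ cut n)) (cut n) (n ∸ cut n)

H : ℕ → ℕ
H n = Hᶠ n n

n∸cut≤ : ∀ {f n} → 2 ≤ n → n ≤ suc f → n ∸ cut n ≤ f
n∸cut≤ {f} {n} 2≤n n≤ = ≤-pred (≤-trans (∸-monoʳ-< {m = n} {n = cut n} {o = 0} (proj₁ (cut-bounds 2≤n)) (<⇒≤ (proj₂ (cut-bounds 2≤n)))) n≤)

Hᶠ-fuel : ∀ f g n → n ≤ f → n ≤ g → Hᶠ f n ≡ Hᶠ g n
Hᶠ-fuel zero    zero    n    _ _ = refl
Hᶠ-fuel zero    (suc g) zero _ _ = refl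
Hᶠ-fuel (suc f) zero    zero _ _ = refl
Hᶠ-fuel (suc f) (suc g) zero _ _ = refl
Hᶠ-fuel (suc f) (suc g) (suc zero) _ _ = refl
Hᶠ-fuel (suc f) (suc g) n@(suc (suc _)) n≤f n≤g = cong₂ (λ x y → join x y (cut n) (n ∸ cut n))
  (Hᶠ-fuel f g (cut n) (cut≤ n≤f) (cut≤ n≤g)) (Hᶠ-fuel f g (n ∸ cut n) (n∸cut≤ 2≤n n≤f) (n∸cut≤ 2≤n n≤g))
  where
  2≤n : 2 ≤ n
  2≤n = s≤s (s≤s z≤n)
  cut≤ : ∀ {f} → n ≤ suc f → cut n ≤ f
  cut≤ n≤ = ≤-pred (≤-trans (proj₂ (cut-bounds 2≤n)) n≤)

H-cut : ∀ {n} → 2 ≤ n → H n ≡ join (H (cut n)) (H (n ∸ cut n)) (cut n) (n ∸ cut n)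
H-cut {suc zero} (s≤s ())
H-cut {n@(suc (suc m))} 2≤n = cong₂ (λ x y → join x y (cut n) (n ∸ cut n))
  (Hᶠ-fuel (suc m) (cut n) (cut n) (≤-pred (proj₂ (cut-bounds 2≤n))) ≤-refl)
  (Hᶠ-fuel (suc m) (n ∸ cut n) (n ∸ cut n) (n∸cut≤ 2≤n ≤-refl) ≤-refl)

cut-window : ∀ {n k} → n ≢ 6 → InWindow k n → cut n ≡ 2 ^ k
cut-window {n} {k} n≢6 w@(window ≤2n _) with n ≡ᵇ 6 in n≡6
... | true = ⊥-elim (n≢6 (≡ᵇ⇒≡ n 6 (subst T (sym n≡6) _)))
... | false = cong (2 ^_) (window-unique (level-window 2≤n) w)
  where
  2≤n : 2 ≤ n
  2≤n = *-cancelˡ-< 2 1 n (≤-trans (*-monoʳ-≤ 3 (m^n>0 2 k)) ≤2n)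

H-window : ∀ {n k} → n ≢ 6 → InWindow k n → H n ≡ join (H (2 ^ k)) (H (n ∸ 2 ^ k)) (2 ^ k) (n ∸ 2 ^ k)
H-window {n} {k} n≢6 w@(window ≤2n _) = subst (λ s → H n ≡ join (H s) (H (n ∸ s)) s (n ∸ s)) (cut-window n≢6 w) (H-cut 2≤n)
  where
  2≤n : 2 ≤ n
  2≤n = *-cancelˡ-< 2 1 n (≤-trans (*-monoʳ-≤ 3 (m^n>0 2 k)) ≤2n)

F : ℕ → ℚ
F n = H n /2^ n

join-/2^ : ∀ x y a b → join x y a b /2^ (a + b) ≡ x /2^ a +ℚ y /2^ b +ℚ φ a b
join-/2^ x y a b = sym (/2^-shift x a b refl ⊞ /2^-shift y b a (+-comm b a) ⊞ refl)

F-window : ∀ k {n c} → 2 ^ k + c ≡ n → n ≢ 6 → 2 ^ k ≤ 2 * c → c < 2 ^ k + 2 ^ k → F n ≡ F (2 ^ k) +ℚ F c +ℚ φ (2 ^ k) c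
F-window k {c = c} refl n≢6 ≤2c c< =
  trans (cong (_/2^ (2 ^ k + c)) (trans (H-window n≢6 (window {k} (linℕ 0 ≤2c (eq (2 ^ k) c)) (linℕ 0 c< (eq′ (2 ^ k) c))))
    (cong (λ d → join (H (2 ^ k)) (H d) (2 ^ k) d) (m+n∸m≡n (2 ^ k) c))))
  (join-/2^ (H (2 ^ k)) (H c) (2 ^ k) c)
  where
  eq : ∀ x c → 3 * x + 2 * c + 0 ≡ 2 * (x + c) + x
  eq = solve-∀
  eq′ : ∀ x c → suc (x + c) + (x + x) + 0 ≡ 3 * x + suc c
  eq′ = solve-∀

-- Comparing cuts

φ-nonneg : ∀ a b → 0ℚ ≤ℚ φ a b
φ-nonneg a b = /2^-nonneg (a * b) (a + b)

-- The strict bound makes it an induction hypothesis: for N = a + b it speaks only of smaller sums.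
Superadditive : ℕ → Set
Superadditive N = ∀ {a b} → 1 ≤ a → 1 ≤ b → a + b < N → F a +ℚ F b +ℚ φ a b ≤ℚ F (a + b)

-- For a + b = h + c with a power of two h = q + q, the fields compare the cut (a, b) with the cut (h, c).
-- The margins 2 / 2^h, φ and φ h a - φ h h are what the induction on q needs.
record Claims (N q : ℕ) : Set where
  field
    below : ∀ {a b c} → a + b ≤ N → a + b ≡ q + q + c → a < q + q → b < q + q → q ≤ c →
      F a +ℚ F b +ℚ 2 /2^ (q + q) ≤ℚ F (q + q) +ℚ F c
    above : ∀ {a b c} → a + b ≤ N → a + b ≡ q + q + c → q + q < a → q + q < b → c < q + q + (q + q) →
      F a +ℚ F b +ℚ φ a b ≤ℚ F (q + q) +ℚ F c +ℚ φ (q + q) c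
    across : ∀ {a b c} → a + b ≤ N → a + b ≡ q + q + c → 1 ≤ a → a < q + q → q + q < b → q ≤ c → c < q + q + (q + q) →
      F a +ℚ F b ≤ℚ F (q + q) +ℚ F c
    across⁺ : ∀ {a b c} → a + b ≤ N → a + b ≡ q + q + c → q ≤ a → a < q + q → q + q < b → b < q + q + (q + q) →
      F a +ℚ F b +ℚ φ (q + q) a ≤ℚ F (q + q) +ℚ F c +ℚ φ (q + q) (q + q)

IsPower : ℕ → Set
IsPower x = ∃ λ k → x ≡ 2 ^ k

IsPower-double : ∀ {x} → IsPower x → IsPower (x + x)
IsPower-double (k , refl) = suc k , 2^n+2^n≡2^[1+n] k

-- The two lower bounds of 4 keep x + c away from the exceptional 6.
F-block : ∀ {x c} → IsPower x → 4 ≤ x → 4 ≤ c → x ≤ c + c → c < x + x → F (x + c) ≡ F x +ℚ F c +ℚ φ x c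
F-block {x} {c} (k , refl) 4≤x 4≤c x≤2c c<2x = F-window k refl
  (λ eq → <-irrefl (sym eq) (≤-trans (s≤s (s≤s (s≤s (s≤s (s≤s (s≤s (s≤s z≤n))))))) (+-mono-≤ 4≤x 4≤c)))
  (≤-trans x≤2c (≤-reflexive (cong (λ z → c + z) (sym (+-identityʳ c))))) c<2x

-- The hypothesis `cl` concerns the power of two q = 2p, the result its double h = 2q. The windows
-- of p, q and h meet at 3p and 3q, written `p + q` and `q + h`; these thresholds decide which power
-- of two is cut off a and b.
module Step {N p} (sup : Superadditive N) (cl : Claims N p) (pow : IsPower p) (4≤p : 4 ≤ p) where
  open Claims cl
  q h : ℕ
  q = p + p
  h = q + q

  1≤p : 1 ≤ p
  1≤p = ≤-trans (s≤s z≤n) 4≤p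

  p≤q : p ≤ q
  p≤q = m≤m+n p p

  q≤h : q ≤ h
  q≤h = m≤m+n q q

  4≤q : 4 ≤ q
  4≤q = ≤-trans 4≤p p≤q

  1≤q : 1 ≤ q
  1≤q = ≤-trans 1≤p p≤q

  8≤q : 8 ≤ q
  8≤q = +-mono-≤ 4≤p 4≤p

  q<h : q < h
  q<h = linℕ 0 1≤q (eq p)
    where
    eq : ∀ p → suc (p + p) + (p + p) + 0 ≡ p + p + (p + p) + 1
    eq = solve-∀

  pow-q : IsPower q
  pow-q = IsPower-double pow

  F-h : F h ≡ F q +ℚ F q +ℚ φ q q
  F-h = F-block pow-q 4≤q 4≤q q≤h q<h

  F-p : ∀ {c} → p < c → c < q → F (p + c) ≡ F p +ℚ F c +ℚ φ p c
  F-p p<c c<q = F-block pow 4≤p (≤-trans 4≤p (<⇒≤ p<c)) (≤-trans (<⇒≤ p<c) (m≤m+n _ _)) c<q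

  F-q : ∀ {c} → p ≤ c → c < h → F (q + c) ≡ F q +ℚ F c +ℚ φ q c
  F-q p≤c c<h = F-block pow-q 4≤q (≤-trans 4≤p p≤c) (+-mono-≤ p≤c p≤c) c<h

  F-h+ : ∀ {c} → q ≤ c → c < h + h → F (h + c) ≡ F h +ℚ F c +ℚ φ h c
  F-h+ q≤c c<2h = F-block (IsPower-double pow-q) (≤-trans 4≤q q≤h) (≤-trans 4≤q q≤c) (+-mono-≤ q≤c q≤c) c<2h

  -- Both parts lie in the window of q. The two copies of F q that they release are those contained
  -- in F h, and superadditivity rejoins a and b.
  below-high : ∀ {a b} → q + a + (q + b) ≤ N → p ≤ a → p ≤ b → a < q → b < q →
    F (q + a) +ℚ F (q + b) +ℚ 2 /2^ h ≤ℚ F h +ℚ F (a + b)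
  below-high {a} {b} ≤N p≤a p≤b a<q b<q = lin (F q) (F a) (F b) (F (a + b)) (φ q a) (φ q b) (φ q q) (φ a b) (2 /2^ h)
    (F-q p≤a (<-trans a<q q<h)) (F-q p≤b (<-trans b<q q<h)) F-h
    (sup (≤-trans 1≤p p≤a) (≤-trans 1≤p p≤b) (≤-trans (linℕ (p + p + p) 1≤p (eq p a b)) ≤N))
    (φ-exchange-below (≤-trans 4≤p p≤a) (≤-trans 4≤p p≤b) a<q b<q)
    where
    eq : ∀ p a b → suc (a + b) + p + (p + p + p) ≡ p + p + a + (p + p + b) + 1
    eq = solve-∀
    lin : ∀ fq fa fb fab φa φb φq φab u {x y z} → x ≡ fq +ℚ fa +ℚ φa → y ≡ fq +ℚ fb +ℚ φb → z ≡ fq +ℚ fq +ℚ φq →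
      fa +ℚ fb +ℚ φab ≤ℚ fab → φa +ℚ φb +ℚ u ≤ℚ φq +ℚ φab → x +ℚ y +ℚ u ≤ℚ z +ℚ fab
    lin fq fa fb fab φa φb φq φab u refl refl refl s e =
      linℚ (ℚₚ.+-mono-≤ s e) (RS.solve (fq ∷ fa ∷ fb ∷ fab ∷ φa ∷ φb ∷ φq ∷ φab ∷ u ∷ []) ℚ-ring)

  -- The smaller part is cut at p and the larger one at q, which leaves an instance of `below` for
  -- q. Its margin 2 / 2^q pays for φ q b, and superadditivity puts p and c together again.
  below-low : ∀ {a b c} → p + a + (q + b) ≤ N → a + b ≡ q + c → p ≤ c → a < q → b < q →
    F (p + a) +ℚ F (q + b) +ℚ 2 /2^ h ≤ℚ F h +ℚ F (p + c)
  below-low {a} {b} {c} ≤N eq p≤c a<q b<q = lin (F p) (F q) (F a) (F b) (F c) (F (p + c)) (φ p a) (φ q b) (φ q q) (φ p c) (2 /2^ h) (2 /2^ q)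
    (F-p p<a a<q) (F-q (<⇒≤ p<b) (<-trans b<q q<h)) F-h
    (below (≤-trans (+-mono-≤ (m≤n+m a p) (m≤n+m b q)) ≤N) eq a<q b<q p≤c)
    (sup 1≤p (≤-trans 1≤p p≤c) (≤-trans (p+c< p a b c (c<a q a b c eq b<q)) ≤N))
    (φ-antitone p (≤-trans 1≤p p≤c) (<⇒≤ (c<a q a b c eq b<q)))
    (φ-half-≤ 4≤p p<b (<⇒≤ b<q))
    where
    c<a : ∀ q a b c → a + b ≡ q + c → b < q → c < a
    c<a q a b c eq b<q = linℕ 0 (+-mono-≤ (≤-reflexive (sym eq)) b<q) (solve (q ∷ a ∷ b ∷ c ∷ []))
    p+c< : ∀ p a b c → c < a → p + c < p + a + (p + p + b)
    p+c< p a b c c<a = linℕ (p + p + b) c<a (solve (p ∷ a ∷ b ∷ c ∷ []))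
    p<a : p < a
    p<a = ≤-trans (s≤s p≤c) (c<a q a b c eq b<q)
    p<b : p < b
    p<b = ≤-trans (s≤s p≤c) (c<a q b a c (trans (+-comm b a) eq) a<q)
    lin : ∀ fp fq fa fb fc fpc φa φb φq φc u v {x y z} → x ≡ fp +ℚ fa +ℚ φa → y ≡ fq +ℚ fb +ℚ φb → z ≡ fq +ℚ fq +ℚ φq →
      fa +ℚ fb +ℚ v ≤ℚ fq +ℚ fc → fp +ℚ fc +ℚ φc ≤ℚ fpc → φa ≤ℚ φc → φb +ℚ u ≤ℚ v +ℚ φq → x +ℚ y +ℚ u ≤ℚ z +ℚ fpc
    lin fp fq fa fb fc fpc φa φb φq φc u v refl refl refl s t e f =
      linℚ (ℚₚ.+-mono-≤ (ℚₚ.+-mono-≤ s t) (ℚₚ.+-mono-≤ e f))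
        (RS.solve (fp ∷ fq ∷ fa ∷ fb ∷ fc ∷ fpc ∷ φa ∷ φb ∷ φq ∷ φc ∷ u ∷ v ∷ []) ℚ-ring)

  below-≤ : ∀ {a b c} → a ≤ b → a + b ≤ N → a + b ≡ h + c → b < h → q ≤ c →
    F a +ℚ F b +ℚ 2 /2^ h ≤ℚ F h +ℚ F c
  -- As b is always in reach of a cut at q, only the position of a relative to 3p matters.
  below-≤ {a} {b} {c} a≤b ≤N eq b<h q≤c = by-cases (p + q ≤? a)
    where
    q≤b : ∀ p a b c → let q = p + p in a + b ≡ q + q + c → q ≤ c → a ≤ b → q ≤ b
    q≤b p a b c eq q≤c a≤b = *-cancelˡ-≤ 2 (linℕ (p + p) (+-mono-≤ (+-mono-≤ (≤-reflexive (sym eq)) q≤c) a≤b) (solve (p ∷ a ∷ b ∷ c ∷ [])))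
    p≤a : ∀ p a b c → let q = p + p in a + b ≡ q + q + c → q ≤ c → b < q + q → p ≤ a
    p≤a p a b c eq q≤c b<h = linℕ (suc p) (+-mono-≤ (+-mono-≤ (≤-reflexive (sym eq)) q≤c) b<h) (solve (p ∷ a ∷ b ∷ c ∷ []))
    p≤c : p ≤ c
    p≤c = ≤-trans p≤q q≤c
    high-sum : ∀ p a b c → let q = p + p in q + a + (q + b) ≡ q + q + c → a + b ≡ c
    high-sum p a b c eq = linℕ-≡ eq (solve (p ∷ a ∷ b ∷ c ∷ []))
    low-sum : ∀ p a b c → let q = p + p in p + a + (q + b) ≡ q + q + (p + c) → a + b ≡ q + c
    low-sum p a b c eq = linℕ-≡ eq (solve (p ∷ a ∷ b ∷ c ∷ []))
    p≤ : ∀ p a → p + (p + p) ≤ p + p + a → p ≤ a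
    p≤ p a 3p≤ = linℕ 0 3p≤ (solve (p ∷ a ∷ []))
    by-cases : Dec (p + q ≤ a) → F a +ℚ F b +ℚ 2 /2^ h ≤ℚ F h +ℚ F c
    by-cases (yes 3p≤a) with m≤n⇒∃[o]m+o≡n (≤-trans (m≤n+m q p) 3p≤a) | m≤n⇒∃[o]m+o≡n (q≤b p a b c eq q≤c a≤b)
    ... | a′ , refl | b′ , refl = subst (λ c → F (q + a′) +ℚ F (q + b′) +ℚ 2 /2^ h ≤ℚ F h +ℚ F c) (high-sum p a′ b′ c eq)
      (below-high ≤N (p≤ p a′ 3p≤a) (≤-trans (p≤ p a′ 3p≤a) a′≤b′) (≤-<-trans a′≤b′ b′<q) b′<q)
      where
      a′≤b′ : a′ ≤ b′
      a′≤b′ = +-cancelˡ-≤ q a′ b′ a≤b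
      b′<q : b′ < q
      b′<q = +-cancelˡ-< q b′ q b<h
    by-cases (no 3p≰a) with m≤n⇒∃[o]m+o≡n (p≤a p a b c eq q≤c b<h) | m≤n⇒∃[o]m+o≡n (q≤b p a b c eq q≤c a≤b) | m≤n⇒∃[o]m+o≡n p≤c
    ... | a′ , refl | b′ , refl | c′ , refl = below-low ≤N (low-sum p a′ b′ c′ eq)
      (+-cancelˡ-≤ p p c′ q≤c) (+-cancelˡ-< p a′ q (≰⇒> 3p≰a)) (+-cancelˡ-< q b′ q b<h)

  below-step : ∀ {a b c} → a + b ≤ N → a + b ≡ h + c → a < h → b < h → q ≤ c →
      F a +ℚ F b +ℚ 2 /2^ h ≤ℚ F h +ℚ F c
  below-step {a} {b} ≤N eq a<h b<h q≤c with ≤-total a b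
  ... | inj₁ a≤b = below-≤ a≤b ≤N eq b<h q≤c
  ... | inj₂ b≤a = subst (λ x → x +ℚ 2 /2^ h ≤ℚ _) (ℚₚ.+-comm (F b) (F a))
    (below-≤ b≤a (subst (_≤ N) (+-comm a b) ≤N) (trans (+-comm b a) eq) a<h q≤c)

  above-weak : ∀ {a b c} → a + b ≤ N → a + b ≡ q + c → q ≤ a → q ≤ b → c < h → F a +ℚ F b ≤ℚ F q +ℚ F c
  above-weak {a} {b} {c} ≤N eq q≤a q≤b c<h with m≤n⇒m<n∨m≡n q≤a | m≤n⇒m<n∨m≡n q≤b
  ... | inj₂ refl | _ = ℚₚ.≤-reflexive (cong (λ x → F q +ℚ F x) (+-cancelˡ-≡ q b c eq))
  ... | inj₁ _ | inj₂ refl = ℚₚ.≤-reflexive (trans (ℚₚ.+-comm (F a) (F q)) (cong (λ x → F q +ℚ F x) (+-cancelˡ-≡ q a c (trans (+-comm q a) eq))))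
  ... | inj₁ q<a | inj₁ q<b = lin (F a +ℚ F b) (F q +ℚ F c) (φ a b) (φ q c) (above ≤N eq q<a q<b c<h) (φ-cut-≤-φ q≤a q≤b eq)
    where
    lin : ∀ x y s t → x +ℚ s ≤ℚ y +ℚ t → t ≤ℚ s → x ≤ℚ y
    lin x y s t u v = linℚ (ℚₚ.+-mono-≤ u v) (RS.solve (x ∷ y ∷ s ∷ t ∷ []) ℚ-ring)

  φ-drop′ : ∀ {b} → q < b → φ q b +ℚ 2 /2^ h ≤ℚ φ q q
  φ-drop′ {b} q<b with m≤n⇒∃[o]m+o≡n q<b
  ... | s , refl = subst (λ b → φ q b +ℚ 2 /2^ h ≤ℚ φ q q) (+-suc q s) (φ-drop 4≤q (s≤s z≤n))

  φ-exchange-above′ : ∀ {a b} → q < a → q < b → φ q a +ℚ φ q b +ℚ 1 /2^ h ≤ℚ φ q q +ℚ φ a b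
  φ-exchange-above′ {a} {b} q<a q<b with m≤n⇒∃[o]m+o≡n q<a | m≤n⇒∃[o]m+o≡n q<b
  ... | s , refl | t , refl = subst₂ (λ a b → φ q a +ℚ φ q b +ℚ 1 /2^ h ≤ℚ φ q q +ℚ φ a b) (+-suc q s) (+-suc q t)
    (φ-exchange-above 4≤q (s≤s z≤n) (s≤s z≤n))

  -- After q is cut off both parts, the exchange of φ values leaves 1 / 2^h, and φ (q + a) (q + b)
  -- is no larger than that.
  above-low : ∀ {a b} → q + a + (q + b) ≤ N → q < a → q < b → a < h → b < h →
    F (q + a) +ℚ F (q + b) +ℚ φ (q + a) (q + b) ≤ℚ F h +ℚ F (a + b) +ℚ φ h (a + b)
  above-low {a} {b} ≤N q<a q<b a<h b<h = lin (F q) (F a) (F b) (F (a + b)) (φ q a) (φ q b) (φ q q) (φ a b) (1 /2^ h) (φ (q + a) (q + b)) (φ h (a + b))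
    (F-q (≤-trans p≤q (<⇒≤ q<a)) a<h) (F-q (≤-trans p≤q (<⇒≤ q<b)) b<h) F-h
    (sup (≤-trans 1≤q (<⇒≤ q<a)) (≤-trans 1≤q (<⇒≤ q<b)) (≤-trans (a+b< q a b 1≤q) ≤N))
    (φ-exchange-above′ q<a q<b)
    (φ-tiny 8≤q (+-monoʳ-≤ q (<⇒≤ q<a)) (+-monoʳ-≤ q (<⇒≤ q<b)))
    (φ-nonneg h (a + b))
    where
    a+b< : ∀ q a b → 1 ≤ q → a + b < q + a + (q + b)
    a+b< q a b 1≤q = linℕ q 1≤q (solve (q ∷ a ∷ b ∷ []))
    lin : ∀ fq fa fb fab φa φb φq φab u s t {x y z} → x ≡ fq +ℚ fa +ℚ φa → y ≡ fq +ℚ fb +ℚ φb → z ≡ fq +ℚ fq +ℚ φq →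
      fa +ℚ fb +ℚ φab ≤ℚ fab → φa +ℚ φb +ℚ u ≤ℚ φq +ℚ φab → s ≤ℚ u → 0ℚ ≤ℚ t → x +ℚ y +ℚ s ≤ℚ z +ℚ fab +ℚ t
    lin fq fa fb fab φa φb φq φab u s t refl refl refl e₁ e₂ e₃ e₄ =
      linℚ (ℚₚ.+-mono-≤ (ℚₚ.+-mono-≤ e₁ e₂) (ℚₚ.+-mono-≤ e₃ e₄))
        (RS.solve (fq ∷ fa ∷ fb ∷ fab ∷ φa ∷ φb ∷ φq ∷ φab ∷ u ∷ s ∷ t ∷ []) ℚ-ring)

  -- The drop from φ q q to φ q a leaves 2 / 2^h. One half pays for φ h b, the other for φ (q + a)
  -- (h + b).
  above-high : ∀ {a b c} → q + a + (h + b) ≤ N → a + b ≡ q + c → q < a → q ≤ b → a < h → b < h → c < h →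
    F (q + a) +ℚ F (h + b) +ℚ φ (q + a) (h + b) ≤ℚ F h +ℚ F (h + c) +ℚ φ h (h + c)
  above-high {a} {b} {c} ≤N eq q<a q≤b a<h b<h c<h =
    lin (F q) (F h) (F a) (F b) (F c) (F (h + c)) (φ q a) (φ h b) (φ q q) (φ h c) (1 /2^ h) (2 /2^ h) (φ (q + a) (h + b)) (φ h (h + c))
    (F-q (≤-trans p≤q (<⇒≤ q<a)) a<h) (F-h+ q≤b (≤-trans b<h (m≤m+n h h))) F-h
    (above-weak (≤-trans (+-mono-≤ (m≤n+m a q) (m≤n+m b h)) ≤N) eq (<⇒≤ q<a) q≤b c<h)
    (sup (≤-trans 1≤q q≤h) (≤-trans 1≤q (≤-trans q≤b (b≤c q a b c eq (<⇒≤ q<a)))) (≤-trans (h+c< q a b c eq 1≤q) ≤N))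
    (φ-drop′ q<a)
    (ℚₚ.≤-reflexive (/2^-+ 1 1 h))
    (φ-double-≤ 8≤q q≤b)
    (φ-tiny 8≤q (+-monoʳ-≤ q (<⇒≤ q<a)) (m≤m+n h b))
    (φ-nonneg h c)
    (φ-nonneg h (h + c))
    where
    b≤c : ∀ q a b c → a + b ≡ q + c → q ≤ a → b ≤ c
    b≤c q a b c eq q≤a = linℕ 0 (+-mono-≤ (≤-reflexive eq) q≤a) (solve (q ∷ a ∷ b ∷ c ∷ []))
    h+c< : ∀ q a b c → a + b ≡ q + c → 1 ≤ q → q + q + c < q + a + (q + q + b)
    h+c< q a b c eq 1≤q = linℕ q (+-mono-≤ (≤-reflexive (sym eq)) 1≤q) (solve (q ∷ a ∷ b ∷ c ∷ []))
    lin : ∀ fq fh fa fb fc fhc φa φb φq φc u v s t {x y} → x ≡ fq +ℚ fa +ℚ φa → y ≡ fh +ℚ fb +ℚ φb → fh ≡ fq +ℚ fq +ℚ φq →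
      fa +ℚ fb ≤ℚ fq +ℚ fc → fh +ℚ fc +ℚ φc ≤ℚ fhc → φa +ℚ v ≤ℚ φq → u +ℚ u ≤ℚ v → φb ≤ℚ u → s ≤ℚ u → 0ℚ ≤ℚ φc → 0ℚ ≤ℚ t →
      x +ℚ y +ℚ s ≤ℚ fh +ℚ fhc +ℚ t
    lin fq fh fa fb fc fhc φa φb φq φc u v s t refl refl refl e₁ e₂ e₃ e₄ e₅ e₆ e₇ e₈ =
      linℚ (ℚₚ.+-mono-≤ (ℚₚ.+-mono-≤ (ℚₚ.+-mono-≤ e₁ e₂) (ℚₚ.+-mono-≤ e₃ e₄)) (ℚₚ.+-mono-≤ (ℚₚ.+-mono-≤ e₅ e₆) (ℚₚ.+-mono-≤ e₇ e₈)))
        (RS.solve (fq ∷ fa ∷ fb ∷ fc ∷ fhc ∷ φa ∷ φb ∷ φq ∷ φc ∷ u ∷ v ∷ s ∷ t ∷ []) ℚ-ring)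

  above-≤ : ∀ {a b c} → a ≤ b → a + b ≤ N → a + b ≡ h + c → h < a → h < b → c < h + h →
    F a +ℚ F b +ℚ φ a b ≤ℚ F h +ℚ F c +ℚ φ h c
  above-≤ {a} {b} {c} a≤b ≤N eq h<a h<b c<2h = by-cases (q + h ≤? b)
    where
    a< : ∀ q a b c → a + b ≡ q + q + c → a ≤ b → c < q + q + (q + q) → a < q + (q + q)
    a< q a b c eq a≤b c< = *-cancelˡ-< 2 a (q + (q + q)) (linℕ 0 (+-mono-≤ (+-mono-≤ (≤-reflexive eq) a≤b) c<) (solve (q ∷ a ∷ b ∷ c ∷ [])))
    q≤ : ∀ q b → q + (q + q) ≤ q + q + b → q ≤ b
    q≤ q b 3q≤ = linℕ 0 3q≤ (solve (q ∷ b ∷ []))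
    low-sum : ∀ q a b c → q + a + (q + b) ≡ q + q + c → a + b ≡ c
    low-sum q a b c eq = linℕ-≡ eq (solve (q ∷ a ∷ b ∷ c ∷ []))
    high-sum : ∀ q a b c → q + a + (q + q + b) ≡ q + q + c → q + (a + b) ≡ c
    high-sum q a b c eq = linℕ-≡ eq (solve (q ∷ a ∷ b ∷ c ∷ []))
    b<h′ : ∀ q a b c → q + a + (q + q + b) ≡ q + q + c → q < a → c < q + q + (q + q) → b < q + q
    b<h′ q a b c eq q<a c< = linℕ 1 (+-mono-≤ (+-mono-≤ (≤-reflexive eq) q<a) c<) (solve (q ∷ a ∷ b ∷ c ∷ []))
    split-sum : ∀ q a b c d → q + (a + b) ≡ c → q + q + d ≡ c → a + b ≡ q + d
    split-sum q a b c d eq eq′ = linℕ-≡ (trans eq (sym eq′)) (solve (q ∷ a ∷ b ∷ d ∷ []))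
    h≤c : ∀ q a b c → q + (a + b) ≡ c → q ≤ a → q + q ≤ c
    h≤c q a b c refl q≤a = +-monoʳ-≤ q (≤-trans q≤a (m≤m+n a b))
    by-cases : Dec (q + h ≤ b) → F a +ℚ F b +ℚ φ a b ≤ℚ F h +ℚ F c +ℚ φ h c
    by-cases (no 3q≰b) with m≤n⇒∃[o]m+o≡n (≤-trans q≤h (<⇒≤ h<a)) | m≤n⇒∃[o]m+o≡n (≤-trans q≤h (<⇒≤ h<b))
    ... | a′ , refl | b′ , refl = subst (λ c → F (q + a′) +ℚ F (q + b′) +ℚ φ (q + a′) (q + b′) ≤ℚ F h +ℚ F c +ℚ φ h c) (low-sum q a′ b′ c eq)
      (above-low ≤N (+-cancelˡ-< q q a′ h<a) (+-cancelˡ-< q q b′ h<b) (≤-<-trans (+-cancelˡ-≤ q a′ b′ a≤b) b′<h) b′<h)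
      where
      b′<h : b′ < h
      b′<h = +-cancelˡ-< q b′ h (≰⇒> 3q≰b)
    by-cases (yes 3q≤b) with m≤n⇒∃[o]m+o≡n (≤-trans q≤h (<⇒≤ h<a)) | m≤n⇒∃[o]m+o≡n (<⇒≤ h<b)
    ... | a′ , refl | b′ , refl with m≤n⇒∃[o]m+o≡n (h≤c q a′ b′ c (high-sum q a′ b′ c eq) (<⇒≤ (+-cancelˡ-< q q a′ h<a)))
    ... | c′ , refl = above-high ≤N (split-sum q a′ b′ c c′ (high-sum q a′ b′ c eq) refl)
      (+-cancelˡ-< q q a′ h<a) (q≤ q b′ 3q≤b) (+-cancelˡ-< q a′ h (a< q (q + a′) (h + b′) c eq a≤b c<2h))
      (b<h′ q a′ b′ c eq (+-cancelˡ-< q q a′ h<a) c<2h) (+-cancelˡ-< h c′ h c<2h)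

  above-step : ∀ {a b c} → a + b ≤ N → a + b ≡ h + c → h < a → h < b → c < h + h →
    F a +ℚ F b +ℚ φ a b ≤ℚ F h +ℚ F c +ℚ φ h c
  above-step {a} {b} {c} ≤N eq h<a h<b c<2h with ≤-total a b
  ... | inj₁ a≤b = above-≤ a≤b ≤N eq h<a h<b c<2h
  ... | inj₂ b≤a = subst (_≤ℚ F h +ℚ F c +ℚ φ h c) (cong₂ _+ℚ_ (ℚₚ.+-comm (F b) (F a)) (φ-comm b a))
    (above-≤ b≤a (subst (_≤ N) (+-comm a b) ≤N) (trans (+-comm b a) eq) h<b h<a c<2h)

  -- Cutting h off the larger part produces φ h b. Together with φ h a on the left and φ h h on the
  -- right this is exactly the shape of `φ-exchange-below`.
  across⁺-far : ∀ {a b} → a + (h + b) ≤ N → q ≤ a → a < h → q ≤ b → b < h →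
    F a +ℚ F (h + b) +ℚ φ h a ≤ℚ F h +ℚ F (a + b) +ℚ φ h h
  across⁺-far {a} {b} ≤N q≤a a<h q≤b b<h = lin (F h) (F a) (F b) (F (a + b)) (φ h a) (φ h b) (φ h h) (φ a b) (2 /2^ (h + h))
    (F-h+ q≤b (≤-trans b<h (m≤m+n h h)))
    (sup (≤-trans 1≤q q≤a) (≤-trans 1≤q q≤b) (≤-trans (a+b< h a b (≤-trans 1≤q q≤h)) ≤N))
    (φ-exchange-below (≤-trans 4≤q q≤a) (≤-trans 4≤q q≤b) a<h b<h)
    (/2^-nonneg 2 (h + h))
    where
    a+b< : ∀ h a b → 1 ≤ h → a + b < a + (h + b)
    a+b< h a b 1≤h = linℕ 0 1≤h (solve (h ∷ a ∷ b ∷ []))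
    lin : ∀ fh fa fb fab φa φb φh φab u {y} → y ≡ fh +ℚ fb +ℚ φb → fa +ℚ fb +ℚ φab ≤ℚ fab →
      φa +ℚ φb +ℚ u ≤ℚ φh +ℚ φab → 0ℚ ≤ℚ u → fa +ℚ y +ℚ φa ≤ℚ fh +ℚ fab +ℚ φh
    lin fh fa fb fab φa φb φh φab u refl e₁ e₂ e₃ =
      linℚ (ℚₚ.+-mono-≤ (ℚₚ.+-mono-≤ e₁ e₂) e₃) (RS.solve (fh ∷ fa ∷ fb ∷ fab ∷ φa ∷ φb ∷ φh ∷ φab ∷ u ∷ []) ℚ-ring)

  across⁺-near : ∀ {a b c} → a + b ≤ N → a + b ≡ q + c → q ≤ a → q < b → b < h → c < h →
    F a +ℚ F (q + b) +ℚ φ h a ≤ℚ F h +ℚ F c +ℚ φ h h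
  across⁺-near {a} {b} {c} ≤N eq q≤a q<b b<h c<h =
    lin (F q) (F a) (F b) (F c) (φ h a) (φ q b) (φ q q) (φ h h) (1 /2^ h) (2 /2^ h)
    (F-q (≤-trans p≤q (<⇒≤ q<b)) b<h) F-h (above-weak ≤N eq q≤a (<⇒≤ q<b) c<h) (φ-drop′ q<b) (φ-double-≤ 8≤q q≤a)
    (ℚₚ.≤-reflexive (/2^-+ 1 1 h)) (/2^-nonneg 1 h) (φ-nonneg h h)
    where
    lin : ∀ fq fa fb fc φa φb φq φh u v {y z} → y ≡ fq +ℚ fb +ℚ φb → z ≡ fq +ℚ fq +ℚ φq → fa +ℚ fb ≤ℚ fq +ℚ fc →
      φb +ℚ v ≤ℚ φq → φa ≤ℚ u → u +ℚ u ≤ℚ v → 0ℚ ≤ℚ u → 0ℚ ≤ℚ φh → fa +ℚ y +ℚ φa ≤ℚ z +ℚ fc +ℚ φh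
    lin fq fa fb fc φa φb φq φh u v refl refl e₁ e₂ e₃ e₄ e₅ e₆ =
      linℚ (ℚₚ.+-mono-≤ (ℚₚ.+-mono-≤ (ℚₚ.+-mono-≤ e₁ e₂) (ℚₚ.+-mono-≤ e₃ e₄)) (ℚₚ.+-mono-≤ e₅ e₆))
        (RS.solve (fq ∷ fa ∷ fb ∷ fc ∷ φa ∷ φb ∷ φq ∷ φh ∷ u ∷ v ∷ []) ℚ-ring)

  -- The larger part loses q twice and the smaller one loses p, down to an instance of `below` for
  -- q. Superadditivity is used twice to build q + (p + c) on the other side.
  across⁺-low : ∀ {a b c} → p + a + (q + (q + b)) ≤ N → a + b ≡ q + c → p ≤ c → a < q → b < q →
    F (p + a) +ℚ F (q + (q + b)) +ℚ φ h (p + a) ≤ℚ F h +ℚ F (q + (p + c)) +ℚ φ h h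
  across⁺-low {a} {b} {c} ≤N eq p≤c a<q b<q =
    lin (F p) (F q) (F a) (F b) (F c) (F (p + c)) (F (q + (p + c))) (φ p a) (φ q b) (φ q (q + b)) (φ q q) (φ p c) (φ q (p + c)) (φ h (p + a)) (φ h h)
        (1 /2^ h) (2 /2^ h) (2 /2^ q)
    (F-p p<a a<q)
    (trans (F-q (≤-trans p≤q (m≤m+n q b)) (+-monoʳ-< q b<q)) (cong (λ x → F q +ℚ x +ℚ φ q (q + b)) (F-q (<⇒≤ p<b) (<-trans b<q q<h))))
    F-h
    (below (≤-trans (a+b≤ p a b) ≤N) eq a<q b<q p≤c)
    (sup 1≤q (≤-trans 1≤p (m≤m+n p c)) (≤-trans (q+p+c< p a b c c<a) ≤N))
    (sup 1≤p (≤-trans 1≤p p≤c) (≤-trans (p+c< p a b c c<a) ≤N))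
    (φ-antitone p (≤-trans 1≤p p≤c) (<⇒≤ c<a))
    (φ-antitone q (≤-trans 1≤p (m≤m+n p c)) (+-mono-≤ p≤q (<⇒≤ c<b)))
    (φ-half-≤ 4≤p p<b (<⇒≤ b<q))
    (φ-double-≤ 8≤q (+-monoʳ-≤ p (<⇒≤ p<a)))
    (ℚₚ.≤-reflexive (/2^-+ 1 1 h)) (/2^-nonneg 1 h) (φ-nonneg h h)
    where
    smaller : ∀ q a b c → a + b ≡ q + c → b < q → c < a
    smaller q a b c eq b<q = linℕ 0 (+-mono-≤ (≤-reflexive (sym eq)) b<q) (solve (q ∷ a ∷ b ∷ c ∷ []))
    c<a : c < a
    c<a = smaller q a b c eq b<q
    c<b : c < b
    c<b = smaller q b a c (trans (+-comm b a) eq) a<q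
    p<a : p < a
    p<a = ≤-trans (s≤s p≤c) c<a
    p<b : p < b
    p<b = ≤-trans (s≤s p≤c) c<b
    a+b≤ : ∀ p a b → a + b ≤ p + a + (p + p + (p + p + b))
    a+b≤ p a b = linℕ (p + p + p + p + p) (z≤n {0}) (solve (p ∷ a ∷ b ∷ []))
    q+p+c< : ∀ p a b c → c < a → p + p + (p + c) < p + a + (p + p + (p + p + b))
    q+p+c< p a b c c<a = linℕ (p + p + b) c<a (solve (p ∷ a ∷ b ∷ c ∷ []))
    p+c< : ∀ p a b c → c < a → p + c < p + a + (p + p + (p + p + b))
    p+c< p a b c c<a = linℕ (p + p + (p + p + b)) c<a (solve (p ∷ a ∷ b ∷ c ∷ []))
    lin : ∀ fp fq fa fb fc fpc fqpc φa φb φqb φq φc φpc φha φh u v w {x y z} →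
      x ≡ fp +ℚ fa +ℚ φa → y ≡ fq +ℚ (fq +ℚ fb +ℚ φb) +ℚ φqb → z ≡ fq +ℚ fq +ℚ φq →
      fa +ℚ fb +ℚ w ≤ℚ fq +ℚ fc → fq +ℚ fpc +ℚ φpc ≤ℚ fqpc → fp +ℚ fc +ℚ φc ≤ℚ fpc → φa ≤ℚ φc → φqb ≤ℚ φpc → φb +ℚ v ≤ℚ w +ℚ φq →
      φha ≤ℚ u → u +ℚ u ≤ℚ v → 0ℚ ≤ℚ u → 0ℚ ≤ℚ φh → x +ℚ y +ℚ φha ≤ℚ z +ℚ fqpc +ℚ φh
    lin fp fq fa fb fc fpc fqpc φa φb φqb φq φc φpc φha φh u v w refl refl refl e₁ e₂ e₃ e₄ e₅ e₆ e₇ e₈ e₉ e₁₀ =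
      linℚ (ℚₚ.+-mono-≤ (ℚₚ.+-mono-≤ (ℚₚ.+-mono-≤ (ℚₚ.+-mono-≤ e₁ e₂) (ℚₚ.+-mono-≤ e₃ e₄)) (ℚₚ.+-mono-≤ (ℚₚ.+-mono-≤ e₅ e₆) (ℚₚ.+-mono-≤ e₇ e₈))) (ℚₚ.+-mono-≤ e₉ e₁₀))
        (RS.solve (fp ∷ fq ∷ fa ∷ fb ∷ fc ∷ fpc ∷ fqpc ∷ φa ∷ φb ∷ φqb ∷ φq ∷ φc ∷ φpc ∷ φha ∷ φh ∷ u ∷ v ∷ w ∷ []) ℚ-ring)

  -- This case dictates the form of `across⁺`. Cutting q off the smaller part produces φ q a and
  -- cutting h in halves produces φ q q, the very terms that `across⁺` for q admits; `φ-step` pays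
  -- for the rest.
  across⁺-high : ∀ {a b c} → q + a + (q + b) ≤ N → a + b ≡ q + c → p ≤ a → a < q → q < b → b < h → 2 ≤ c →
    F (q + a) +ℚ F (q + b) +ℚ φ h (q + a) ≤ℚ F h +ℚ F (q + c) +ℚ φ h h
  across⁺-high {a} {b} {c} ≤N eq p≤a a<q q<b b<h 2≤c =
    lin (F q) (F a) (F b) (F c) (F (q + c)) (φ q a) (φ q b) (φ q q) (φ q c) (φ h (q + a)) (φ h h)
    (F-q p≤a (<-trans a<q q<h)) (F-q (≤-trans p≤q (<⇒≤ q<b)) b<h) F-h
    (across⁺ (≤-trans (+-mono-≤ (m≤n+m a q) (m≤n+m b q)) ≤N) eq p≤a a<q q<b b<h)
    (sup 1≤q (≤-trans (s≤s z≤n) 2≤c) (≤-trans (q+c< q a b c eq 1≤q) ≤N))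
    (φ-step 4≤p (+-monoʳ-≤ q p≤a) 2≤c (c<b q a b c eq a<q) b<h)
    (φ-nonneg h h)
    where
    c<b : ∀ q a b c → a + b ≡ q + c → a < q → c < b
    c<b q a b c eq a<q = linℕ 0 (+-mono-≤ (≤-reflexive (sym eq)) a<q) (solve (q ∷ a ∷ b ∷ c ∷ []))
    q+c< : ∀ q a b c → a + b ≡ q + c → 1 ≤ q → q + c < q + a + (q + b)
    q+c< q a b c eq 1≤q = linℕ q (+-mono-≤ (≤-reflexive (sym eq)) 1≤q) (solve (q ∷ a ∷ b ∷ c ∷ []))
    lin : ∀ fq fa fb fc fqc φa φb φq φc φha φh {x y z} → x ≡ fq +ℚ fa +ℚ φa → y ≡ fq +ℚ fb +ℚ φb → z ≡ fq +ℚ fq +ℚ φq →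
      fa +ℚ fb +ℚ φa ≤ℚ fq +ℚ fc +ℚ φq → fq +ℚ fc +ℚ φc ≤ℚ fqc → φb +ℚ φha ≤ℚ φc → 0ℚ ≤ℚ φh → x +ℚ y +ℚ φha ≤ℚ z +ℚ fqc +ℚ φh
    lin fq fa fb fc fqc φa φb φq φc φha φh refl refl refl e₁ e₂ e₃ e₄ =
      linℚ (ℚₚ.+-mono-≤ (ℚₚ.+-mono-≤ e₁ e₂) (ℚₚ.+-mono-≤ e₃ e₄))
        (RS.solve (fq ∷ fa ∷ fb ∷ fc ∷ fqc ∷ φa ∷ φb ∷ φq ∷ φc ∷ φha ∷ φh ∷ []) ℚ-ring)

  across⁺-step : ∀ {a b c} → a + b ≤ N → a + b ≡ h + c → q ≤ a → a < h → h < b → b < h + h →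
    F a +ℚ F b +ℚ φ h a ≤ℚ F h +ℚ F c +ℚ φ h h
  across⁺-step {a} {b} {c} ≤N eq q≤a a<h h<b b<2h = by-cases (q + h ≤? b) (c <? h) (p + q ≤? a)
    where
    Goal : ℕ → ℕ → ℕ → Set
    Goal a b c = F a +ℚ F b +ℚ φ h a ≤ℚ F h +ℚ F c +ℚ φ h h
    p≤ : ∀ p a → p + (p + p) ≤ p + p + a → p ≤ a
    p≤ p a 3p≤ = linℕ 0 3p≤ (solve (p ∷ a ∷ []))
    far-sum : ∀ h a b c → a + (h + b) ≡ h + c → a + b ≡ c
    far-sum h a b c eq = linℕ-≡ eq (solve (h ∷ a ∷ b ∷ c ∷ []))
    near-sum : ∀ q a b c → a + (q + b) ≡ q + q + c → a + b ≡ q + c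
    near-sum q a b c eq = linℕ-≡ eq (solve (q ∷ a ∷ b ∷ c ∷ []))
    high-sum : ∀ q a b c → q + a + (q + b) ≡ q + q + (q + c) → a + b ≡ q + c
    high-sum q a b c eq = linℕ-≡ eq (solve (q ∷ a ∷ b ∷ c ∷ []))
    low-sum : ∀ p a b c → let q = p + p in p + a + (q + (q + b)) ≡ q + q + (q + (p + c)) → a + b ≡ q + c
    low-sum p a b c eq = linℕ-≡ eq (solve (p ∷ a ∷ b ∷ c ∷ []))
    3p≤c : ∀ p c → let q = p + p in q + q ≤ c → q + p ≤ c
    3p≤c p c h≤c = ≤-trans (+-monoʳ-≤ (p + p) (m≤m+n p p)) h≤c
    p≤c : ∀ p c → let q = p + p in q + q ≤ q + p + c → p ≤ c
    p≤c p c h≤ = linℕ 0 h≤ (solve (p ∷ c ∷ []))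
    by-cases : Dec (q + h ≤ b) → Dec (c < h) → Dec (p + q ≤ a) → Goal a b c
    by-cases (yes 3q≤b) _ _ with m≤n⇒∃[o]m+o≡n (<⇒≤ h<b)
    ... | b′ , refl = subst (Goal a (h + b′)) (far-sum h a b′ c eq)
      (across⁺-far ≤N q≤a a<h (+-cancelˡ-≤ q q b′ (+-cancelˡ-≤ q (q + q) (q + b′) (≤-trans 3q≤b (≤-reflexive (+-assoc q q b′))))) (+-cancelˡ-< h b′ h b<2h))
    by-cases (no 3q≰b) (yes c<h) _ with m≤n⇒∃[o]m+o≡n (≤-trans q≤h (<⇒≤ h<b))
    ... | b′ , refl = across⁺-near (≤-trans (+-monoʳ-≤ a (m≤n+m b′ q)) ≤N) (near-sum q a b′ c eq) q≤a
      (+-cancelˡ-< q q b′ h<b) (+-cancelˡ-< q b′ h (≰⇒> 3q≰b)) c<h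
    by-cases (no 3q≰b) (no c≮h) (no 3p≰a) with m≤n⇒∃[o]m+o≡n (≤-trans p≤q q≤a) | m≤n⇒∃[o]m+o≡n (<⇒≤ h<b) | m≤n⇒∃[o]m+o≡n (3p≤c p c (≮⇒≥ c≮h))
    ... | a′ , refl | b′ , refl | c′ , refl = subst₂ (Goal (p + a′)) (sym (+-assoc q q b′)) (sym (+-assoc q p c′))
      (across⁺-low (subst (λ b → p + a′ + b ≤ N) (+-assoc q q b′) ≤N)
        (low-sum p a′ b′ c′ (subst₂ (λ x y → p + a′ + x ≡ h + y) (+-assoc q q b′) (+-assoc q p c′) eq))
        (p≤c p c′ (≮⇒≥ c≮h)) (+-cancelˡ-< p a′ q (≰⇒> 3p≰a))
        (+-cancelˡ-< q b′ q (+-cancelˡ-< q (q + b′) (q + q) (subst (_< q + h) (+-assoc q q b′) (≰⇒> 3q≰b)))))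
    by-cases (no 3q≰b) (no c≮h) (yes 3p≤a) with m≤n⇒∃[o]m+o≡n q≤a | m≤n⇒∃[o]m+o≡n (≤-trans q≤h (<⇒≤ h<b)) | m≤n⇒∃[o]m+o≡n (≤-trans q≤h (≮⇒≥ c≮h))
    ... | a′ , refl | b′ , refl | c′ , refl = across⁺-high ≤N (high-sum q a′ b′ c′ eq) (p≤ p a′ 3p≤a)
      (+-cancelˡ-< q a′ q a<h) (+-cancelˡ-< q q b′ h<b) (+-cancelˡ-< q b′ h (≰⇒> 3q≰b))
      (≤-trans (≤-trans (s≤s (s≤s z≤n)) 4≤q) (+-cancelˡ-≤ q q c′ (≮⇒≥ c≮h)))

  across-far : ∀ {a b} → a + (h + b) ≤ N → 1 ≤ a → a < h → q ≤ b → b < h + h → F a +ℚ F (h + b) ≤ℚ F h +ℚ F (a + b)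
  across-far {a} {b} ≤N 1≤a a<h q≤b b<2h = lin (F h) (F a) (F b) (F (a + b)) (φ h b) (φ a b) (F-h+ q≤b b<2h)
    (sup 1≤a (≤-trans 1≤q q≤b) (≤-trans (a+b< h a b (≤-trans 1≤q q≤h)) ≤N))
    (subst₂ _≤ℚ_ (φ-comm b h) (φ-comm b a) (φ-antitone b 1≤a (<⇒≤ a<h)))
    where
    a+b< : ∀ h a b → 1 ≤ h → a + b < a + (h + b)
    a+b< h a b 1≤h = linℕ 0 1≤h (solve (h ∷ a ∷ b ∷ []))
    lin : ∀ fh fa fb fab φb φab {y} → y ≡ fh +ℚ fb +ℚ φb → fa +ℚ fb +ℚ φab ≤ℚ fab → φb ≤ℚ φab → fa +ℚ y ≤ℚ fh +ℚ fab
    lin fh fa fb fab φb φab refl e₁ e₂ = linℚ (ℚₚ.+-mono-≤ e₁ e₂) (RS.solve (fh ∷ fa ∷ fb ∷ fab ∷ φb ∷ φab ∷ []) ℚ-ring)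

  across-low : ∀ {a b c} → a + (q + b) ≤ N → a + b ≡ q + c → 1 ≤ a → a < q → q < b → b < h → q ≤ c → c < h →
    F a +ℚ F (q + b) ≤ℚ F h +ℚ F c
  across-low {a} {b} {c} ≤N eq 1≤a a<q q<b b<h q≤c c<h = lin (F q) (F a) (F b) (F c) (φ q b) (φ q q)
    (F-q (≤-trans p≤q (<⇒≤ q<b)) b<h) F-h
    (across (≤-trans (+-monoʳ-≤ a (m≤n+m b q)) ≤N) eq 1≤a a<q q<b (≤-trans p≤q q≤c) c<h)
    (φ-antitone q 1≤q (<⇒≤ q<b))
    where
    lin : ∀ fq fa fb fc φb φq {y z} → y ≡ fq +ℚ fb +ℚ φb → z ≡ fq +ℚ fq +ℚ φq → fa +ℚ fb ≤ℚ fq +ℚ fc → φb ≤ℚ φq → fa +ℚ y ≤ℚ z +ℚ fc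
    lin fq fa fb fc φb φq refl refl e₁ e₂ = linℚ (ℚₚ.+-mono-≤ e₁ e₂) (RS.solve (fq ∷ fa ∷ fb ∷ fc ∷ φb ∷ φq ∷ []) ℚ-ring)

  across-step : ∀ {a b c} → a + b ≤ N → a + b ≡ h + c → 1 ≤ a → a < h → h < b → q ≤ c → c < h + h →
    F a +ℚ F b ≤ℚ F h +ℚ F c
  across-step {a} {b} {c} ≤N eq 1≤a a<h h<b q≤c c<2h = by-cases (q + h ≤? b) (q ≤? a)
    where
    far-sum : ∀ h a b c → a + (h + b) ≡ h + c → a + b ≡ c
    far-sum h a b c eq = linℕ-≡ eq (solve (h ∷ a ∷ b ∷ c ∷ []))
    near-sum : ∀ q a b c → a + (q + b) ≡ q + q + c → a + b ≡ q + c
    near-sum q a b c eq = linℕ-≡ eq (solve (q ∷ a ∷ b ∷ c ∷ []))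
    c<h : ∀ q a b c → a + b ≡ q + c → a < q → b < q + q → c < q + q
    c<h q a b c eq a<q b<h = linℕ 1 (+-mono-≤ (≤-reflexive (sym eq)) (+-mono-≤ a<q b<h)) (solve (q ∷ a ∷ b ∷ c ∷ []))
    by-cases : Dec (q + h ≤ b) → Dec (q ≤ a) → F a +ℚ F b ≤ℚ F h +ℚ F c
    by-cases (yes 3q≤b) _ with m≤n⇒∃[o]m+o≡n (<⇒≤ h<b)
    ... | b′ , refl with far-sum h a b′ c eq
    ... | refl = across-far ≤N 1≤a a<h
      (+-cancelˡ-≤ q q b′ (+-cancelˡ-≤ q (q + q) (q + b′) (≤-trans 3q≤b (≤-reflexive (+-assoc q q b′))))) (≤-<-trans (m≤n+m b′ a) c<2h)
    -- Here the stronger `across⁺` holds, and its extra terms can be discarded since φ h h ≤ φ h a.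
    by-cases (no 3q≰b) (yes q≤a) = lin (F a +ℚ F b) (F h +ℚ F c) (φ h a) (φ h h)
      (across⁺-step ≤N eq q≤a a<h h<b (≤-trans (≰⇒> 3q≰b) (+-monoˡ-≤ h q≤h)))
      (φ-antitone h 1≤a (<⇒≤ a<h))
      where
      lin : ∀ x y s t → x +ℚ s ≤ℚ y +ℚ t → t ≤ℚ s → x ≤ℚ y
      lin x y s t u v = linℚ (ℚₚ.+-mono-≤ u v) (RS.solve (x ∷ y ∷ s ∷ t ∷ []) ℚ-ring)
    by-cases (no 3q≰b) (no q≰a) with m≤n⇒∃[o]m+o≡n (≤-trans q≤h (<⇒≤ h<b))
    ... | b′ , refl = across-low ≤N (near-sum q a b′ c eq) 1≤a (≰⇒> q≰a) (+-cancelˡ-< q q b′ h<b) b′<h q≤c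
        (c<h q a b′ c (near-sum q a b′ c eq) (≰⇒> q≰a) b′<h)
      where
      b′<h : b′ < h
      b′<h = +-cancelˡ-< q b′ h (≰⇒> 3q≰b)

  claims : Claims N q
  claims = record { below = below-step ; above = above-step ; across = across-step ; across⁺ = across⁺-step }

-- The base case h = 8 by evaluation

φ-24 : ∀ {a b} → a + b ≤ 24 → φ a b ≡ (a * b * 2 ^ (24 ∸ (a + b))) /2^ 24
φ-24 {a} {b} ≤24 = /2^-shift (a * b) (a + b) (24 ∸ (a + b)) (m+[n∸m]≡n ≤24)

-- Opaque because the type checker would otherwise compare numerals near 2^24 in unary.
opaque
  G : ℕ → ℕ
  G n = H n * 2 ^ (24 ∸ n)

  F-G : ∀ {n} → n ≤ 24 → F n ≡ G n /2^ 24
  F-G {n} n≤24 = /2^-shift (H n) n (24 ∸ n) (m+[n∸m]≡n n≤24)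

  superadditive-check : ∀ {a} → a < 24 → ∀ {b} → b < 24 → 1 ≤ a × 1 ≤ b × a + b < 24 →
    G a + G b + a * b * 2 ^ (24 ∸ (a + b)) ≤ G (a + b)
  superadditive-check = toWitness {a? = allUpTo? (λ a → allUpTo? (λ b →
    (1 ≤? a ×-dec 1 ≤? b ×-dec a + b <? 24) →-dec (G a + G b + a * b * 2 ^ (24 ∸ (a + b)) ≤? G (a + b))) 24) 24} _

  below-check : ∀ {a} → a < 8 → ∀ {b} → b < 8 → 12 ≤ a + b → G a + G b + 2 * 2 ^ 16 ≤ G 8 + G (a + b ∸ 8)
  below-check = toWitness {a? = allUpTo? (λ a → allUpTo? (λ b →
    (12 ≤? a + b) →-dec (G a + G b + 2 * 2 ^ 16 ≤? G 8 + G (a + b ∸ 8))) 8) 8} _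

  above-check : ∀ {a} → a < 24 → ∀ {b} → b < 24 → 8 < a × 8 < b × a + b < 24 →
    G a + G b + a * b * 2 ^ (24 ∸ (a + b)) ≤ G 8 + G (a + b ∸ 8) + 8 * (a + b ∸ 8) * 2 ^ (24 ∸ (a + b))
  above-check = toWitness {a? = allUpTo? (λ a → allUpTo? (λ b → (8 <? a ×-dec 8 <? b ×-dec a + b <? 24) →-dec
    (G a + G b + a * b * 2 ^ (24 ∸ (a + b)) ≤? G 8 + G (a + b ∸ 8) + 8 * (a + b ∸ 8) * 2 ^ (24 ∸ (a + b)))) 24) 24} _

  across-check : ∀ {a} → a < 8 → ∀ {b} → b < 24 → 1 ≤ a × 8 < b × 12 ≤ a + b × a + b < 24 → G a + G b ≤ G 8 + G (a + b ∸ 8)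
  across-check = toWitness {a? = allUpTo? (λ a → allUpTo? (λ b → (1 ≤? a ×-dec 8 <? b ×-dec 12 ≤? a + b ×-dec a + b <? 24) →-dec
    (G a + G b ≤? G 8 + G (a + b ∸ 8))) 24) 8} _

  across⁺-check : ∀ {a} → a < 8 → ∀ {b} → b < 16 → 4 ≤ a × 8 < b →
    G a + G b + 8 * a * 2 ^ (24 ∸ (8 + a)) ≤ G 8 + G (a + b ∸ 8) + 8 * 8 * 2 ^ 8
  across⁺-check = toWitness {a? = allUpTo? (λ a → allUpTo? (λ b → (4 ≤? a ×-dec 8 <? b) →-dec
    (G a + G b + 8 * a * 2 ^ (24 ∸ (8 + a)) ≤? G 8 + G (a + b ∸ 8) + 8 * 8 * 2 ^ 8)) 16) 8} _

-- For h = 8 all sums concerned stay below 3 * 8 = 24, so 2^24 is a common denominator and finitely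
-- many pairs (a, b) remain. Over it the margin 2 / 2^8 has numerator 2 * 2^16.
claims₄ : ∀ {N} → Claims N 4
claims₄ = record
  { below = λ {a} {b} {c} _ eq a<8 b<8 4≤c → ≤-via-/2^ 24
      (F-G (≤-trans (<⇒≤ a<8) 8≤24) ⊞ F-G (≤-trans (<⇒≤ b<8) 8≤24) ⊞ /2^-shift 2 8 16 refl)
      (F-G 8≤24 ⊞ F-G {c} (≤-trans (c≤ eq) (≤-trans (+-mono-≤ (<⇒≤ a<8) (<⇒≤ b<8)) (≤ᵇ⇒≤ 16 24 _))))
      (subst (λ c → G a + G b + 2 * 2 ^ 16 ≤ G 8 + G c) (cong (_∸ 8) eq)
        (below-check a<8 b<8 (≤-trans (+-monoʳ-≤ 8 4≤c) (≤-reflexive (sym eq)))))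
  ; above = λ {a} {b} {c} _ eq 8<a 8<b c<16 →
      let a+b<24 = subst (_< 24) (sym eq) (+-monoʳ-< 8 c<16)
          a<24 = ≤-<-trans (m≤m+n a b) a+b<24
          b<24 = ≤-<-trans (m≤n+m b a) a+b<24
      in ≤-via-/2^ 24
      (F-G (<⇒≤ a<24) ⊞ F-G (<⇒≤ b<24) ⊞ φ-24 {a} {b} (<⇒≤ a+b<24))
      (F-G 8≤24 ⊞ F-G {c} (≤-trans (c≤ eq) (<⇒≤ a+b<24))
        ⊞ trans (φ-24 {8} {c} (+-monoʳ-≤ 8 (<⇒≤ c<16))) (cong (λ s → (8 * c * 2 ^ (24 ∸ s)) /2^ 24) (sym eq)))
      (subst (λ c → G a + G b + a * b * 2 ^ (24 ∸ (a + b)) ≤ G 8 + G c + 8 * c * 2 ^ (24 ∸ (a + b))) (cong (_∸ 8) eq)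
        (above-check a<24 b<24 (8<a , 8<b , a+b<24)))
  ; across = λ {a} {b} {c} _ eq 1≤a a<8 8<b 4≤c c<16 →
      let a+b<24 = subst (_< 24) (sym eq) (+-monoʳ-< 8 c<16)
          b<24 = ≤-<-trans (m≤n+m b a) a+b<24
      in ≤-via-/2^ 24 (F-G (≤-trans (<⇒≤ a<8) 8≤24) ⊞ F-G (<⇒≤ b<24)) (F-G 8≤24 ⊞ F-G {c} (≤-trans (c≤ eq) (<⇒≤ a+b<24)))
      (subst (λ c → G a + G b ≤ G 8 + G c) (cong (_∸ 8) eq)
        (across-check a<8 b<24 (1≤a , 8<b , ≤-trans (+-monoʳ-≤ 8 4≤c) (≤-reflexive (sym eq)) , a+b<24)))
  ; across⁺ = λ {a} {b} {c} _ eq 4≤a a<8 8<b b<16 → ≤-via-/2^ 24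
      (F-G (≤-trans (<⇒≤ a<8) 8≤24) ⊞ F-G (≤-trans (<⇒≤ b<16) (≤ᵇ⇒≤ 16 24 _))
        ⊞ φ-24 {8} {a} (+-monoʳ-≤ 8 (≤-trans (<⇒≤ a<8) (≤ᵇ⇒≤ 8 16 _))))
      (F-G 8≤24 ⊞ F-G {c} (≤-trans (c≤ eq) (+-mono-≤ (<⇒≤ a<8) (<⇒≤ b<16))) ⊞ φ-24 {8} {8} (≤ᵇ⇒≤ 16 24 _))
      (subst (λ c → G a + G b + 8 * a * 2 ^ (24 ∸ (8 + a)) ≤ G 8 + G c + 8 * 8 * 2 ^ 8) (cong (_∸ 8) eq)
        (across⁺-check a<8 b<16 (4≤a , 8<b)))
  }
  where
  8≤24 : 8 ≤ 24
  8≤24 = ≤ᵇ⇒≤ 8 24 _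
  c≤ : ∀ {s c} → s ≡ 8 + c → c ≤ s
  c≤ {c = c} refl = m≤n+m c 8

-- Superadditivity for all sums

half : ℕ → ℕ
half zero = 4
half (suc j) = half j + half j

half≡2^ : ∀ j → half j ≡ 2 ^ (2 + j)
half≡2^ zero = refl
half≡2^ (suc j) = trans (cong (λ x → x + x) (half≡2^ j)) (2^n+2^n≡2^[1+n] (2 + j))

4≤half : ∀ j → 4 ≤ half j
4≤half zero = ≤-refl
4≤half (suc j) = ≤-trans (4≤half j) (m≤m+n (half j) (half j))

-- The sequence `half` grows by adding a number to itself, so that the result of `Step` has the
-- required type by definition.
claims-at : ∀ {N} → Superadditive N → ∀ j → Claims N (half j)
claims-at sup zero = claims₄
claims-at sup (suc j) = Step.claims sup (claims-at sup j) (2 + j , half≡2^ j) (4≤half j)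

-- The terms φ a b and φ h c are accounted for by the position of h. If both parts are below h, the
-- margin 2 / 2^h pays for φ a b. If h lies between them, the φ terms compare on their own and
-- `across` does the rest. If both are above, `above` already contains the φ terms.
best-cut-≤ : ∀ {N q a b c} → Claims N q → 8 ≤ q → a ≤ b → a + b ≤ N → a + b ≡ q + q + c → 1 ≤ a → q ≤ c → c < q + q + (q + q) →
  F a +ℚ F b +ℚ φ a b ≤ℚ F (q + q) +ℚ F c +ℚ φ (q + q) c
best-cut-≤ {N} {q} {a} {b} {c} cl 8≤q a≤b ≤N eq 1≤a q≤c c<2h = by-cases (<-cmp a h) (<-cmp b h)
  where
  open Claims cl
  h = q + q
  by-cases : _ → _ → F a +ℚ F b +ℚ φ a b ≤ℚ F h +ℚ F c +ℚ φ h c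
  by-cases (tri≈ _ refl _) _ with +-cancelˡ-≡ h b c eq
  ... | refl = ℚₚ.≤-refl
  by-cases (tri> _ _ h<a) _ = above ≤N eq h<a (<-≤-trans h<a a≤b) c<2h
  by-cases (tri< a<h _ _) (tri≈ _ refl _) with +-cancelˡ-≡ h a c (trans (+-comm h a) eq)
  ... | refl = ℚₚ.≤-reflexive (cong₂ _+ℚ_ (ℚₚ.+-comm (F a) (F h)) (φ-comm a h))
  by-cases (tri< a<h _ _) (tri> _ _ h<b) = ℚₚ.+-mono-≤ (across ≤N eq 1≤a a<h h<b q≤c c<2h) (φ-≤-φ-cut (<⇒≤ a<h) (<⇒≤ h<b) eq)
  by-cases (tri< a<h _ _) (tri< b<h _ _) = ℚₚ.≤-trans
    (ℚₚ.≤-trans (ℚₚ.+-monoʳ-≤ (F a +ℚ F b) (φ-below-≤ 8≤q a<h b<h eq q≤c)) (below ≤N eq a<h b<h q≤c))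
    (ℚₚ.≤-trans (ℚₚ.≤-reflexive (sym (ℚₚ.+-identityʳ (F h +ℚ F c)))) (ℚₚ.+-monoʳ-≤ (F h +ℚ F c) (φ-nonneg h c)))

best-cut : ∀ {N q a b c} → Claims N q → 8 ≤ q → a + b ≤ N → a + b ≡ q + q + c → 1 ≤ a → 1 ≤ b → q ≤ c → c < q + q + (q + q) →
  F a +ℚ F b +ℚ φ a b ≤ℚ F (q + q) +ℚ F c +ℚ φ (q + q) c
best-cut {N} {q} {a} {b} {c} cl 8≤q ≤N eq 1≤a 1≤b q≤c c<2h with ≤-total a b
... | inj₁ a≤b = best-cut-≤ cl 8≤q a≤b ≤N eq 1≤a q≤c c<2h
... | inj₂ b≤a = subst (_≤ℚ F (q + q) +ℚ F c +ℚ φ (q + q) c) (cong₂ _+ℚ_ (ℚₚ.+-comm (F b) (F a)) (φ-comm b a))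
  (best-cut-≤ cl 8≤q b≤a (subst (_≤ N) (+-comm a b) ≤N) (trans (+-comm b a) eq) 1≤b q≤c c<2h)

superadditive-at : ∀ {a b k} → 24 ≤ a + b → InWindow k (a + b) → Superadditive (a + b) → 1 ≤ a → 1 ≤ b → F a +ℚ F b +ℚ φ a b ≤ℚ F (a + b)
superadditive-at {a} {b} {k} 24≤ (window lo up) sup 1≤a 1≤b with 4 ≤? k
-- A level of at most 3 would put a + b below 3 * 2^3 = 24.
... | no 4≰k = ⊥-elim (<-irrefl refl (<-≤-trans up (≤-trans (*-monoʳ-≤ 3 (^-monoʳ-≤ 2 (≤-pred (≰⇒> 4≰k)))) 24≤)))
... | yes 4≤k with m≤n⇒∃[o]m+o≡n 4≤k
... | j , refl = result (m≤n⇒∃[o]m+o≡n h≤a+b)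
  where
  q = half (suc j)
  h≡ : q + q ≡ 2 ^ (4 + j)
  h≡ = half≡2^ (2 + j)
  lo′ : 3 * (q + q) ≤ 2 * (a + b)
  lo′ = subst (λ h → 3 * h ≤ 2 * (a + b)) (sym h≡) lo
  up′ : a + b < 3 * (q + q)
  up′ = subst (λ h → a + b < 3 * h) (sym h≡) up
  h≤a+b : q + q ≤ a + b
  h≤a+b = *-cancelˡ-≤ 2 (≤-trans (*-monoˡ-≤ (q + q) (≤ᵇ⇒≤ 2 3 _)) lo′)
  q≤c : ∀ q c → 3 * (q + q) ≤ 2 * (q + q + c) → q ≤ c
  q≤c q c lo = *-cancelˡ-≤ 2 (linℕ 0 lo (solve (q ∷ c ∷ [])))
  c< : ∀ q c → q + q + c < 3 * (q + q) → c < q + q + (q + q)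
  c< q c up = linℕ 0 up (solve (q ∷ c ∷ []))
  result : (∃ λ c → q + q + c ≡ a + b) → F a +ℚ F b +ℚ φ a b ≤ℚ F (a + b)
  result (c , eq) = subst (F a +ℚ F b +ℚ φ a b ≤ℚ_) (trans (sym F≡) (cong F eq))
    (best-cut (claims-at sup (suc j)) 8≤q ≤-refl (sym eq) 1≤a 1≤b q≤c′ c<2h)
    where
    8≤q : 8 ≤ q
    8≤q = +-mono-≤ (4≤half j) (4≤half j)
    q≤c′ : q ≤ c
    q≤c′ = q≤c q c (subst (λ s → 3 * (q + q) ≤ 2 * s) (sym eq) lo′)
    c<2h : c < q + q + (q + q)
    c<2h = c< q c (subst (_< 3 * (q + q)) (sym eq) up′)
    F≡ : F (q + q + c) ≡ F (q + q) +ℚ F c +ℚ φ (q + q) c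
    F≡ = F-block (4 + j , h≡) (≤-trans (4≤half (suc j)) (m≤m+n q q)) (≤-trans (4≤half (suc j)) q≤c′) (+-mono-≤ q≤c′ q≤c′) c<2h

F-superadditive : ∀ {a b} → 1 ≤ a → 1 ≤ b → F a +ℚ F b +ℚ φ a b ≤ℚ F (a + b)
F-superadditive {a} {b} 1≤a 1≤b = <-rec P step (a + b) refl 1≤a 1≤b
  where
  P : ℕ → Set
  P n = ∀ {a b} → a + b ≡ n → 1 ≤ a → 1 ≤ b → F a +ℚ F b +ℚ φ a b ≤ℚ F (a + b)
  step : ∀ n → (∀ {m} → m < n → P m) → P n
  step n rec {a} {b} refl 1≤a 1≤b with 24 ≤? a + b
  ... | yes 24≤ = superadditive-at {k = level (a + b)} 24≤ (level-window (+-mono-≤ 1≤a 1≤b)) (λ 1≤a 1≤b lt → rec lt refl 1≤a 1≤b) 1≤a 1≤b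
  ... | no 24≰ = ≤-via-/2^ 24
    (F-G (≤-trans (m≤m+n a b) (<⇒≤ a+b<24)) ⊞ F-G (≤-trans (m≤n+m b a) (<⇒≤ a+b<24)) ⊞ φ-24 {a} {b} (<⇒≤ a+b<24)) (F-G (<⇒≤ a+b<24))
    (superadditive-check (≤-<-trans (m≤m+n a b) a+b<24) (≤-<-trans (m≤n+m b a) a+b<24) (1≤a , 1≤b , a+b<24))
    where
    a+b<24 : a + b < 24
    a+b<24 = ≰⇒> 24≰

join-≤-H : ∀ {a b} → 1 ≤ a → 1 ≤ b → join (H a) (H b) a b ≤ H (a + b)
join-≤-H {a} {b} 1≤a 1≤b = /2^-cancel (a + b) (ℚₚ.≤-trans (ℚₚ.≤-reflexive (join-/2^ (H a) (H b) a b)) (F-superadditive 1≤a 1≤b))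

-- Weights of 2-recursive multigraphs

sumFin-cong : ∀ n {f g : Fin n → ℕ} → (∀ x → f x ≡ g x) → sumFin n f ≡ sumFin n g
sumFin-cong zero    f≗g = refl
sumFin-cong (suc n) f≗g = cong₂ _+_ (f≗g Fin.zero) (sumFin-cong n (f≗g ∘ Fin.suc))

sumFin-+ : ∀ n (f g : Fin n → ℕ) → sumFin n (λ x → f x + g x) ≡ sumFin n f + sumFin n g
sumFin-+ zero    f g = refl
sumFin-+ (suc n) f g = trans (cong (λ z → f Fin.zero + g Fin.zero + z) (sumFin-+ n (f ∘ Fin.suc) (g ∘ Fin.suc)))
  (eq (f Fin.zero) (g Fin.zero) (sumFin n (f ∘ Fin.suc)) (sumFin n (g ∘ Fin.suc)))
  where
  eq : ∀ a b c d → a + b + (c + d) ≡ a + c + (b + d)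
  eq = solve-∀

sumFin-*ʳ : ∀ n (f : Fin n → ℕ) c → sumFin n (λ x → f x * c) ≡ sumFin n f * c
sumFin-*ʳ zero    f c = refl
sumFin-*ʳ (suc n) f c = trans (cong (λ z → f Fin.zero * c + z) (sumFin-*ʳ n (f ∘ Fin.suc) c)) (sym (*-distribʳ-+ c (f Fin.zero) _))

sumFin-*ˡ : ∀ n (f : Fin n → ℕ) c → sumFin n (λ x → c * f x) ≡ c * sumFin n f
sumFin-*ˡ n f c = trans (sumFin-cong n (λ x → *-comm c (f x))) (trans (sumFin-*ʳ n f c) (*-comm _ c))

sumPairs : ∀ n → (Fin n → Fin n → ℕ) → ℕ
sumPairs n f = sumFin n (λ x → sumFin n (λ y → if toℕ x <ᵇ toℕ y then f x y else 0))

sumPairs-cong : ∀ n {f g : Fin n → Fin n → ℕ} → (∀ x y → toℕ x < toℕ y → f x y ≡ g x y) → sumPairs n f ≡ sumPairs n g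
sumPairs-cong n {f} {g} f≗g = sumFin-cong n (λ x → sumFin-cong n (λ y → pointwise x y (toℕ x <ᵇ toℕ y) (<ᵇ⇒< (toℕ x) (toℕ y))))
  where
  pointwise : ∀ x y b → (T b → toℕ x < toℕ y) → (if b then f x y else 0) ≡ (if b then g x y else 0)
  pointwise x y true  x<y = f≗g x y (x<y _)
  pointwise x y false _   = refl

sumPairs-+ : ∀ n (f g : Fin n → Fin n → ℕ) → sumPairs n (λ x y → f x y + g x y) ≡ sumPairs n f + sumPairs n g
sumPairs-+ n f g = trans
  (sumFin-cong n (λ x → trans (sumFin-cong n (λ y → if-+ (toℕ x <ᵇ toℕ y) (f x y) (g x y))) (sumFin-+ n _ _)))
  (sumFin-+ n _ _)
  where
  if-+ : ∀ b s t → (if b then s + t else 0) ≡ (if b then s else 0) + (if b then t else 0)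
  if-+ true  s t = refl
  if-+ false s t = refl

sumPairs-*ʳ : ∀ n (f : Fin n → Fin n → ℕ) c → sumPairs n (λ x y → f x y * c) ≡ sumPairs n f * c
sumPairs-*ʳ n f c = trans
  (sumFin-cong n (λ x → trans (sumFin-cong n (λ y → if-* (toℕ x <ᵇ toℕ y) (f x y))) (sumFin-*ʳ n _ c)))
  (sumFin-*ʳ n _ c)
  where
  if-* : ∀ b s → (if b then s * c else 0) ≡ (if b then s else 0) * c
  if-* true  s = refl
  if-* false s = refl

-- Expanding the product of the sums gives each pair x < y in both orders, plus diagonal terms f x *
-- g x, which vanish. For indicators of disjoint sets it counts the crossing pairs.
sumPairs-cross : ∀ n (f g : Fin n → ℕ) → (∀ x → f x * g x ≡ 0) → sumPairs n (λ x y → f x * g y + g x * f y) ≡ sumFin n f * sumFin n g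
sumPairs-cross zero    f g fg≡0 = refl
sumPairs-cross (suc n) f g fg≡0 = begin
  sumFin n (λ y → a * g (Fin.suc y) + b * f (Fin.suc y)) + sumPairs n (λ x y → f (Fin.suc x) * g (Fin.suc y) + g (Fin.suc x) * f (Fin.suc y))
    ≡⟨ cong₂ _+_ (trans (sumFin-+ n _ _) (cong₂ _+_ (sumFin-*ˡ n (g ∘ Fin.suc) a) (sumFin-*ˡ n (f ∘ Fin.suc) b)))
                 (sumPairs-cross n (f ∘ Fin.suc) (g ∘ Fin.suc) (fg≡0 ∘ Fin.suc)) ⟩
  a * B + b * A + A * B              ≡⟨⟩
  0 + (a * B + b * A + A * B)        ≡⟨ cong (λ z → z + (a * B + b * A + A * B)) (sym (fg≡0 Fin.zero)) ⟩
  a * b + (a * B + b * A + A * B)    ≡⟨ eq a b A B ⟩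
  (a + A) * (b + B)                  ∎
  where
  open ≡-Reasoning
  a = f Fin.zero
  b = g Fin.zero
  A = sumFin n (f ∘ Fin.suc)
  B = sumFin n (g ∘ Fin.suc)
  eq : ∀ a b A B → a * b + (a * B + b * A + A * B) ≡ (a + A) * (b + B)
  eq = solve-∀

sumPairs-square : ∀ n (f : Fin n → ℕ) → 2 * sumPairs n (λ x y → f x * f y) + sumFin n (λ x → f x * f x) ≡ sumFin n f * sumFin n f
sumPairs-square zero    f = refl
sumPairs-square (suc n) f = begin
  2 * (sumFin n (λ y → a * f (Fin.suc y)) + P) + (a * a + Q)    ≡⟨ cong (λ s → 2 * (s + P) + (a * a + Q)) (sumFin-*ˡ n (f ∘ Fin.suc) a) ⟩
  2 * (a * A + P) + (a * a + Q)                                  ≡⟨ eq a A P Q ⟩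
  a * a + 2 * (a * A) + (2 * P + Q)                              ≡⟨ cong (λ z → a * a + 2 * (a * A) + z) (sumPairs-square n (f ∘ Fin.suc)) ⟩
  a * a + 2 * (a * A) + A * A                                    ≡⟨ eq′ a A ⟩
  (a + A) * (a + A)                                              ∎
  where
  open ≡-Reasoning
  a = f Fin.zero
  A = sumFin n (f ∘ Fin.suc)
  P = sumPairs n (λ x y → f (Fin.suc x) * f (Fin.suc y))
  Q = sumFin n (λ x → f (Fin.suc x) * f (Fin.suc x))
  eq : ∀ a A P Q → 2 * (a * A + P) + (a * a + Q) ≡ a * a + 2 * (a * A) + (2 * P + Q)
  eq = solve-∀
  eq′ : ∀ a A → a * a + 2 * (a * A) + A * A ≡ (a + A) * (a + A)
  eq′ = solve-∀

bit : Bool → ℕ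
bit true  = 1
bit false = 0

indicator : ∀ {m} → Subset m → Fin m → ℕ
indicator V x = bit (x ∈ᵇ V)

sumFin-indicator : ∀ {m} (V : Subset m) → sumFin m (indicator V) ≡ Subset.∣ V ∣
sumFin-indicator []ᵛ          = refl
sumFin-indicator (true ∷ᵛ V)  = cong suc (sumFin-indicator V)
sumFin-indicator (false ∷ᵛ V) = sumFin-indicator V

-- The parts of a recursive multigraph live on subsets of one fixed vertex set. Indicators as
-- factors turn the split of V into algebra inside a single sum.
weightOn : ∀ {m} → Subset m → Mult m → ℕ
weightOn {m} V g = sumPairs m (λ x y → indicator V x * indicator V y * 2 ^ g x y)

weightOn-⊤ : ∀ {m} (g : Mult m) → weightOn ⊤ g ≡ weight m g
weightOn-⊤ {m} g = sumPairs-cong m (λ x y _ → trans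
  (cong₂ (λ s t → bit s * bit t * 2 ^ g x y) (lookup-replicate x true) (lookup-replicate y true)) (+-identityʳ _))

-- Every pair inside V contributes 2^0 = 1, so the weight is the number of pairs; the doubled form
-- avoids division.
weightOn-0 : ∀ {m} (V : Subset m) → 2 * weightOn V (λ _ _ → 0) + Subset.∣ V ∣ ≡ Subset.∣ V ∣ * Subset.∣ V ∣
weightOn-0 {m} V = begin
  2 * weightOn V (λ _ _ → 0) + Subset.∣ V ∣
    ≡⟨ cong₂ (λ s t → 2 * s + t) (sumPairs-cong m (λ x y _ → *-identityʳ _))
         (trans (sym (sumFin-indicator V)) (sumFin-cong m (λ x → bit-idem (x ∈ᵇ V)))) ⟩
  2 * sumPairs m (λ x y → indicator V x * indicator V y) + sumFin m (λ x → indicator V x * indicator V x)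
    ≡⟨ sumPairs-square m (indicator V) ⟩
  sumFin m (indicator V) * sumFin m (indicator V)    ≡⟨ cong₂ _*_ (sumFin-indicator V) (sumFin-indicator V) ⟩
  Subset.∣ V ∣ * Subset.∣ V ∣                        ∎
  where
  open ≡-Reasoning
  bit-idem : ∀ b → bit b ≡ bit b * bit b
  bit-idem true  = refl
  bit-idem false = refl

weightOn-small : ∀ {m} (V : Subset m) → Subset.∣ V ∣ ≡ 1 ⊎ Subset.∣ V ∣ ≡ 2 → weightOn V (λ _ _ → 0) ≡ H Subset.∣ V ∣
weightOn-small V (inj₁ eq) rewrite eq = m+n≡0⇒m≡0 _ (+-cancelʳ-≡ 1 _ 0 (subst (λ n → 2 * weightOn V (λ _ _ → 0) + n ≡ n * n) eq (weightOn-0 V)))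
weightOn-small V (inj₂ eq) rewrite eq = *-cancelˡ-≡ _ 1 2 (+-cancelʳ-≡ 2 _ 2 (subst (λ n → 2 * weightOn V (λ _ _ → 0) + n ≡ n * n) eq (weightOn-0 V)))

record Partition {m} (V V₁ V₂ : Subset m) : Set where
  field
    union    : V₁ ∪ V₂ ≡ V
    disjoint : Disjoint V₁ V₂

  ∈-union : ∀ x → x ∈ᵇ V ≡ (x ∈ᵇ V₁) ∨ (x ∈ᵇ V₂)
  ∈-union x = trans (cong (x ∈ᵇ_) (sym union)) (lookup-zipWith _∨_ x V₁ V₂)

  indicator-+ : ∀ x → indicator V x ≡ indicator V₁ x + indicator V₂ x
  indicator-+ x = trans (cong bit (∈-union x)) (bit-∨ (x ∈ᵇ V₁) (x ∈ᵇ V₂) (disjoint x))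
    where
    bit-∨ : ∀ a b → a ∧ b ≡ false → bit (a ∨ b) ≡ bit a + bit b
    bit-∨ true  false _ = refl
    bit-∨ false b     _ = refl

  size : Subset.∣ V ∣ ≡ Subset.∣ V₁ ∣ + Subset.∣ V₂ ∣
  size = begin
    Subset.∣ V ∣                                          ≡⟨ sumFin-indicator V ⟨
    sumFin m (indicator V)                                ≡⟨ sumFin-cong m indicator-+ ⟩
    sumFin m (λ x → indicator V₁ x + indicator V₂ x)      ≡⟨ sumFin-+ m (indicator V₁) (indicator V₂) ⟩
    sumFin m (indicator V₁) + sumFin m (indicator V₂)     ≡⟨ cong₂ _+_ (sumFin-indicator V₁) (sumFin-indicator V₂) ⟩
    Subset.∣ V₁ ∣ + Subset.∣ V₂ ∣                         ∎
    where open ≡-Reasoning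

SupportedOn : ∀ {m} → Subset m → Mult m → Set
SupportedOn V g = ∀ x y → (x ∈ᵇ V) ∧ (y ∈ᵇ V) ≡ false → g x y ≡ 0

-- Multiplicities are added over the whole vertex set, so the weight of a split decomposes only if
-- neither part contributes outside its own subset.
Rec2-supported : ∀ {m} {V : Subset m} {g} → Rec2 V g → SupportedOn V g
Rec2-supported (small _) x y _ = refl
Rec2-supported (split {V} {V₁} {V₂} _ refl disj _ _ r₁ r₂) x y xy∉V =
  cong₂ _+_ (cong₂ _+_ (Rec2-supported r₁ x y ∉V₁) (Rec2-supported r₂ x y ∉V₂)) (G₃-zero (not (toℕ x ≡ᵇ toℕ y)) _ _ ∉V₁ ∉V₂)
  where
  outside-∨ : ∀ a b c d → (a ∨ b) ∧ (c ∨ d) ≡ false → a ∧ c ≡ false × b ∧ d ≡ false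
  outside-∨ false false c d _ = refl , refl
  outside-∨ false true  c false _ = refl , refl
  outside-∨ false true  false true ()
  outside-∨ false true  true true ()
  outside-∨ true  false false d _ = refl , refl
  outside-∨ true  true  false false _ = refl , refl
  ∉ : (x ∈ᵇ V₁) ∧ (y ∈ᵇ V₁) ≡ false × (x ∈ᵇ V₂) ∧ (y ∈ᵇ V₂) ≡ false
  ∉ = outside-∨ (x ∈ᵇ V₁) (x ∈ᵇ V₂) (y ∈ᵇ V₁) (y ∈ᵇ V₂)
    (trans (sym (cong₂ _∧_ (lookup-zipWith _∨_ x V₁ V₂) (lookup-zipWith _∨_ y V₁ V₂))) xy∉V)
  ∉V₁ = proj₁ ∉
  ∉V₂ = proj₂ ∉
  G₃-zero : ∀ n {a b} s t → a ≡ false → b ≡ false → (if n ∧ a then s else (if n ∧ b then t else 0)) ≡ 0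
  G₃-zero true  s t refl refl = refl
  G₃-zero false s t refl refl = refl

-- Pairs inside V₁ receive ∣V₂∣ further copies and so the factor 2^∣V₂∣, and symmetrically. A
-- crossing pair has multiplicity 0 and contributes 1, which gives the product of the sizes.
weightOn-split : ∀ {m} {V V₁ V₂ : Subset m} {g₁ g₂} → Partition V V₁ V₂ → SupportedOn V₁ g₁ → SupportedOn V₂ g₂ →
  weightOn V ((g₁ ⊕ g₂) ⊕ G₃ V₁ V₂) ≡ join (weightOn V₁ g₁) (weightOn V₂ g₂) Subset.∣ V₁ ∣ Subset.∣ V₂ ∣
weightOn-split {m} {V} {V₁} {V₂} {g₁} {g₂} part supp₁ supp₂ = begin
  weightOn V ((g₁ ⊕ g₂) ⊕ G₃ V₁ V₂)
    ≡⟨ sumPairs-cong m pointwise ⟩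
  sumPairs m (λ x y → i₁ x * i₁ y * 2 ^ g₁ x y * 2 ^ n₂ + i₂ x * i₂ y * 2 ^ g₂ x y * 2 ^ n₁ + (i₁ x * i₂ y + i₂ x * i₁ y))
    ≡⟨ trans (sumPairs-+ m _ _) (cong₂ _+_ (sumPairs-+ m _ _) refl) ⟩
  sumPairs m (λ x y → i₁ x * i₁ y * 2 ^ g₁ x y * 2 ^ n₂) + sumPairs m (λ x y → i₂ x * i₂ y * 2 ^ g₂ x y * 2 ^ n₁)
    + sumPairs m (λ x y → i₁ x * i₂ y + i₂ x * i₁ y)
    ≡⟨ cong₂ _+_ (cong₂ _+_ (sumPairs-*ʳ m _ (2 ^ n₂)) (sumPairs-*ʳ m _ (2 ^ n₁)))
         (trans (sumPairs-cross m i₁ i₂ (λ x → bit-* (x ∈ᵇ V₁) (x ∈ᵇ V₂) (disjoint x))) (cong₂ _*_ (sumFin-indicator V₁) (sumFin-indicator V₂))) ⟩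
  join (weightOn V₁ g₁) (weightOn V₂ g₂) n₁ n₂  ∎
  where
  open ≡-Reasoning
  open Partition part
  i₁ = indicator V₁
  i₂ = indicator V₂
  n₁ = Subset.∣ V₁ ∣
  n₂ = Subset.∣ V₂ ∣
  bit-* : ∀ a b → a ∧ b ≡ false → bit a * bit b ≡ 0
  bit-* true  false _ = refl
  bit-* false b     _ = refl
  bits : ∀ a b c d s t → a ∧ b ≡ false → c ∧ d ≡ false → (a ∧ c ≡ false → s ≡ 0) → (b ∧ d ≡ false → t ≡ 0) →
    (bit a + bit b) * (bit c + bit d) * 2 ^ (s + t + (if a ∧ c then n₂ else (if b ∧ d then n₁ else 0)))
      ≡ bit a * bit c * 2 ^ s * 2 ^ n₂ + bit b * bit d * 2 ^ t * 2 ^ n₁ + (bit a * bit d + bit b * bit c)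
  bits true false true false s t _ _ _ t≡0 rewrite t≡0 refl | +-identityʳ s =
    trans (+-identityʳ _) (trans (^-distribˡ-+-* 2 s n₂) (trans (cong (_* 2 ^ n₂) (sym (+-identityʳ (2 ^ s)))) (sym (trans (+-identityʳ _) (+-identityʳ _)))))
  bits true false false true s t _ _ s≡0 t≡0 rewrite s≡0 refl | t≡0 refl = refl
  bits true false false false s t _ _ _ _ = refl
  bits false true true false s t _ _ s≡0 t≡0 rewrite s≡0 refl | t≡0 refl = refl
  bits false true false true s t _ _ s≡0 _ rewrite s≡0 refl =
    trans (+-identityʳ _) (trans (^-distribˡ-+-* 2 t n₁) (trans (cong (_* 2 ^ n₁) (sym (+-identityʳ (2 ^ t)))) (sym (+-identityʳ _))))
  bits false true false false s t _ _ _ _ = refl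
  bits false false c d s t _ _ _ _ = refl
  G₃-bits : ∀ x y → toℕ x < toℕ y → G₃ V₁ V₂ x y ≡ (if (x ∈ᵇ V₁) ∧ (y ∈ᵇ V₁) then n₂ else (if (x ∈ᵇ V₂) ∧ (y ∈ᵇ V₂) then n₁ else 0))
  G₃-bits x y x<y with toℕ x ≡ᵇ toℕ y | ≡ᵇ⇒≡ (toℕ x) (toℕ y)
  ... | true  | eq = ⊥-elim (<⇒≢ x<y (eq _))
  ... | false | _  = refl
  pointwise : ∀ x y → toℕ x < toℕ y → indicator V x * indicator V y * 2 ^ ((g₁ ⊕ g₂) ⊕ G₃ V₁ V₂) x y
    ≡ i₁ x * i₁ y * 2 ^ g₁ x y * 2 ^ n₂ + i₂ x * i₂ y * 2 ^ g₂ x y * 2 ^ n₁ + (i₁ x * i₂ y + i₂ x * i₁ y)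
  pointwise x y x<y = trans
    (cong₂ (λ s t → s * 2 ^ (g₁ x y + g₂ x y + t)) (cong₂ _*_ (indicator-+ x) (indicator-+ y)) (G₃-bits x y x<y))
    (bits (x ∈ᵇ V₁) (x ∈ᵇ V₂) (y ∈ᵇ V₁) (y ∈ᵇ V₂) (g₁ x y) (g₂ x y) (disjoint x) (disjoint y) (supp₁ x y) (supp₂ x y))

nonempty-size : ∀ {m} (V : Subset m) → ¬ Empty V → 1 ≤ Subset.∣ V ∣
-- The hypothesis is a double negation and yields no element; instead size 0 is shown to imply
-- emptiness, as deleting an element would make the size negative.
nonempty-size V ¬empty = n≢0⇒n>0 (λ size≡0 → ¬empty (λ (x , x∈V) → n≮0 (≤-trans (x∈p⇒∣p-x∣<∣p∣ x∈V) (≤-reflexive size≡0))))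

weightOn-≤-H : ∀ {m} {V : Subset m} {g} → Rec2 V g → weightOn V g ≤ H Subset.∣ V ∣
weightOn-≤-H (small {V} size) = ≤-reflexive (weightOn-small V size)
weightOn-≤-H (split {V} {V₁} {V₂} {g₁} {g₂} _ union disj ¬empty₁ ¬empty₂ r₁ r₂) = begin
  weightOn V ((g₁ ⊕ g₂) ⊕ G₃ V₁ V₂)                          ≡⟨ weightOn-split part (Rec2-supported r₁) (Rec2-supported r₂) ⟩
  join (weightOn V₁ g₁) (weightOn V₂ g₂) n₁ n₂               ≤⟨ +-monoˡ-≤ (n₁ * n₂) (+-mono-≤ (*-monoˡ-≤ (2 ^ n₂) (weightOn-≤-H r₁)) (*-monoˡ-≤ (2 ^ n₁) (weightOn-≤-H r₂))) ⟩
  join (H n₁) (H n₂) n₁ n₂                                   ≤⟨ join-≤-H (nonempty-size V₁ ¬empty₁) (nonempty-size V₂ ¬empty₂) ⟩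
  H (n₁ + n₂)                                                ≡⟨ cong H (Partition.size part) ⟨
  H Subset.∣ V ∣                                             ∎
  where
  open ≤-Reasoning
  n₁ = Subset.∣ V₁ ∣
  n₂ = Subset.∣ V₂ ∣
  part : Partition V V₁ V₂
  part = record { union = union ; disjoint = disj }

partition-of-size : ∀ {m} (V : Subset m) a b → Subset.∣ V ∣ ≡ a + b →
  Σ (Subset m) λ V₁ → Σ (Subset m) λ V₂ → Partition V V₁ V₂ × Subset.∣ V₁ ∣ ≡ a × Subset.∣ V₂ ∣ ≡ b
partition-of-size []ᵛ zero zero _ = []ᵛ , []ᵛ , record { union = refl ; disjoint = λ () } , refl , refl
partition-of-size (false ∷ᵛ V) a b eq with partition-of-size V a b eq
... | V₁ , V₂ , part , s₁ , s₂ = false ∷ᵛ V₁ , false ∷ᵛ V₂ ,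
  record { union = cong (false ∷ᵛ_) (Partition.union part) ; disjoint = λ { Fin.zero → refl ; (Fin.suc x) → Partition.disjoint part x } } , s₁ , s₂
partition-of-size (true ∷ᵛ V) (suc a) b eq with partition-of-size V a b (suc-injective eq)
... | V₁ , V₂ , part , s₁ , s₂ = true ∷ᵛ V₁ , false ∷ᵛ V₂ ,
  record { union = cong (true ∷ᵛ_) (Partition.union part) ; disjoint = λ { Fin.zero → refl ; (Fin.suc x) → Partition.disjoint part x } } , cong suc s₁ , s₂
partition-of-size (true ∷ᵛ V) zero (suc b) eq with partition-of-size V zero b (suc-injective eq)
... | V₁ , V₂ , part , s₁ , s₂ = false ∷ᵛ V₁ , true ∷ᵛ V₂ ,
  record { union = cong (true ∷ᵛ_) (Partition.union part) ; disjoint = λ { Fin.zero → refl ; (Fin.suc x) → Partition.disjoint part x } } , s₁ , cong suc s₂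

size-nonempty : ∀ {m} {V : Subset m} → 1 ≤ Subset.∣ V ∣ → ¬ Empty V
size-nonempty {m} 1≤ empty = n≮0 (subst (1 ≤_) (trans (cong Subset.∣_∣ (Empty-unique empty)) (∣⊥∣≡0 m)) 1≤)

-- The extremal multigraph follows the recursion of `H`: V is split into parts of sizes `cut n` and
-- `n ∸ cut n`, and which vertices go where is immaterial.
H-attained : ∀ {m} n (V : Subset m) → Subset.∣ V ∣ ≡ n → 1 ≤ n → Σ (Mult m) λ g → Rec2 V g × weightOn V g ≡ H n
H-attained {m} = <-rec P step
  where
  P : ℕ → Set
  P n = (V : Subset m) → Subset.∣ V ∣ ≡ n → 1 ≤ n → Σ (Mult m) λ g → Rec2 V g × weightOn V g ≡ H n
  step : ∀ n → (∀ {k} → k < n → P k) → P n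
  step 1 _ V eq _ = _ , small (inj₁ eq) , trans (weightOn-small V (inj₁ eq)) (cong H eq)
  step 2 _ V eq _ = _ , small (inj₂ eq) , trans (weightOn-small V (inj₂ eq)) (cong H eq)
  step n@(suc (suc (suc _))) rec V eq _ with partition-of-size V (cut n) (n ∸ cut n) (trans eq (sym (m+[n∸m]≡n (<⇒≤ (proj₂ (cut-bounds (s≤s (s≤s z≤n))))))))
  ... | V₁ , V₂ , part , s₁ , s₂
    with rec (proj₂ (cut-bounds {n} (s≤s (s≤s z≤n)))) V₁ s₁ 1≤cut | rec (s≤s (n∸cut≤ {n = n} (s≤s (s≤s z≤n)) ≤-refl)) V₂ s₂ 1≤rest
    where
    1≤cut : 1 ≤ cut n
    1≤cut = proj₁ (cut-bounds {n} (s≤s (s≤s z≤n)))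
    1≤rest : 1 ≤ n ∸ cut n
    1≤rest = m<n⇒0<n∸m (proj₂ (cut-bounds {n} (s≤s (s≤s z≤n))))
  ... | g₁ , r₁ , w₁ | g₂ , r₂ , w₂ = _ ,
    split (subst (3 ≤_) (sym eq) (s≤s (s≤s (s≤s z≤n)))) (Partition.union part) (Partition.disjoint part)
      (size-nonempty (subst (1 ≤_) (sym s₁) (proj₁ (cut-bounds {n} (s≤s (s≤s z≤n))))))
      (size-nonempty (subst (1 ≤_) (sym s₂) (m<n⇒0<n∸m (proj₂ (cut-bounds {n} (s≤s (s≤s z≤n))))))) r₁ r₂ ,
    trans (weightOn-split part (Rec2-supported r₁) (Rec2-supported r₂))
      (trans (trans (cong₂ (join (weightOn V₁ g₁) (weightOn V₂ g₂)) s₁ s₂) (cong₂ (λ x y → join x y (cut n) (n ∸ cut n)) w₁ w₂))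
        (sym (H-cut {n} (s≤s (s≤s z≤n)))))

IsH2-H : ∀ {m} → 1 ≤ m → IsH2 m (H m)
IsH2-H {m} 1≤m with H-attained m ⊤ (∣⊤∣≡n m) 1≤m
... | g , r , w = (g , r , trans (sym (weightOn-⊤ g)) w) ,
  λ g r → subst₂ _≤_ (weightOn-⊤ g) (cong H (∣⊤∣≡n m)) (weightOn-≤-H r)

IsH2-unique : ∀ {m h} → 1 ≤ m → IsH2 m h → h ≡ H m
IsH2-unique {m} 1≤m ((g , r , refl) , upper) with IsH2-H 1≤m
... | (g′ , r′ , w′) , upper′ = ≤-antisym (upper′ g r) (subst (_≤ _) w′ (upper g′ r′))

-- The limit

-- Copies of x are split off one at a time. An empty remainder is treated separately, since
-- superadditivity requires both parts to be positive; there no further copy is left.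
F-multiple : ∀ t {x n} → 1 ≤ x → t * x ≤ n → (t * H x) /2^ x ≤ℚ F n
F-multiple zero {x} {n} _ _ = ℚₚ.≤-trans (ℚₚ.≤-reflexive (0/2^ x)) (/2^-nonneg (H n) n)
F-multiple (suc t) {x} 1≤x tx≤n with m≤n⇒∃[o]m+o≡n (≤-trans (m≤m+n x (t * x)) tx≤n)
... | zero , refl = ≤-via-/2^ (x + 0) (cong ((suc t * H x) /2^_) (sym (+-identityʳ x))) refl
  (≤-reflexive (trans (cong (λ t → suc t * H x) t≡0) (trans (+-identityʳ (H x)) (cong H (sym (+-identityʳ x))))))
  where
  t≡0 : t ≡ 0
  t≡0 = m*n≡0⇒m≡0 t x {{>-nonZero 1≤x}} (n≤0⇒n≡0 (+-cancelˡ-≤ x (t * x) 0 tx≤n))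
... | suc n , refl = ℚₚ.≤-trans (ℚₚ.≤-reflexive (sym (/2^-+ (H x) (t * H x) x)))
  (ℚₚ.≤-trans (ℚₚ.+-monoʳ-≤ (F x) (F-multiple t 1≤x (+-cancelˡ-≤ x (t * x) (suc n) tx≤n)))
    (lin (F x +ℚ F (suc n)) (φ x (suc n)) (F (x + suc n)) (F-superadditive 1≤x (s≤s z≤n)) (φ-nonneg x (suc n))))
  where
  lin : ∀ a b c → a +ℚ b ≤ℚ c → 0ℚ ≤ℚ b → a ≤ℚ c
  lin a b c e₁ e₂ = linℚ (ℚₚ.+-mono-≤ e₁ e₂) (RS.solve (a ∷ b ∷ c ∷ []) ℚ-ring)

S-suc : ∀ j → S (suc j) ≡ S j +ℚ 2 ^ j /2^ (2 ^ suc j)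
S-suc j = cong (S j +ℚ_) (sym (/2^-/ (2 ^ j) (2 ^ suc j)))

S-mono : ∀ K d → S K ≤ℚ S (d + K)
S-mono K zero = ℚₚ.≤-refl
S-mono K (suc d) = ℚₚ.≤-trans (S-mono K d) (ℚₚ.≤-trans (ℚₚ.≤-reflexive (sym (ℚₚ.+-identityʳ (S (d + K)))))
  (ℚₚ.≤-trans (ℚₚ.+-monoʳ-≤ (S (d + K)) (/2^-nonneg (2 ^ (d + K)) (2 ^ suc (d + K)))) (ℚₚ.≤-reflexive (sym (S-suc (d + K))))))

-- S j + 1 / 2^j does not increase, so it bounds all later partial sums. The new term is at most 1 /
-- 2^(j + 1) because 2j + 1 ≤ 2^(j + 1).
S-tail-step : ∀ j → S (suc j) +ℚ 1 /2^ suc j ≤ℚ S j +ℚ 1 /2^ j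
S-tail-step j = ℚₚ.≤-trans (ℚₚ.≤-reflexive (trans (cong (_+ℚ 1 /2^ suc j) (S-suc j)) (ℚₚ.+-assoc (S j) (2 ^ j /2^ (2 ^ suc j)) (1 /2^ suc j))))
  (ℚₚ.+-monoʳ-≤ (S j) (ℚₚ.≤-trans (ℚₚ.+-monoˡ-≤ (1 /2^ suc j) term≤) (ℚₚ.≤-reflexive (trans (/2^-+ 1 1 (suc j)) (sym (/2^-shift 1 j 1 (+-comm j 1)))))))
  where
  2j+1≤ : j + suc j ≤ 2 ^ suc j
  2j+1≤ = ≤-trans (+-mono-≤ (≤-trans (n≤1+n j) (n<2^n j)) (n<2^n j)) (≤-reflexive (2^n+2^n≡2^[1+n] j))
  term≤ : 2 ^ j /2^ (2 ^ suc j) ≤ℚ 1 /2^ suc j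
  term≤ with m≤n⇒∃[o]m+o≡n 2j+1≤
  ... | d , eq = ≤-via-/2^ (2 ^ suc j) refl (/2^-shift 1 (suc j) (j + d) (trans (assoc j d) eq))
    (≤-trans (^-monoʳ-≤ 2 (m≤m+n j d)) (≤-reflexive (sym (+-identityʳ (2 ^ (j + d))))))
    where
    assoc : ∀ j d → suc j + (j + d) ≡ j + suc j + d
    assoc = solve-∀

S-tail : ∀ K d → S (d + K) +ℚ 1 /2^ (d + K) ≤ℚ S K +ℚ 1 /2^ K
S-tail K zero = ℚₚ.≤-refl
S-tail K (suc d) = ℚₚ.≤-trans (S-tail-step (d + K)) (S-tail K d)

S-≤ : ∀ K d → S (d + K) ≤ℚ S K +ℚ 1 /2^ K
S-≤ K d = ℚₚ.≤-trans (ℚₚ.≤-trans (ℚₚ.≤-reflexive (sym (ℚₚ.+-identityʳ (S (d + K))))) (ℚₚ.+-monoʳ-≤ (S (d + K)) (/2^-nonneg 1 (d + K)))) (S-tail K d)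

2^k≢6 : ∀ k → 2 ^ k ≢ 6
2^k≢6 zero ()
2^k≢6 (suc zero) ()
2^k≢6 (suc (suc zero)) ()
2^k≢6 (suc (suc (suc k))) eq = <⇒≢ (≤-trans (≤ᵇ⇒≤ 7 8 _) (^-monoʳ-≤ 2 {x = 3} {y = 3 + k} (m≤m+n 3 k))) (sym eq)

F-2^suc : ∀ k → F (2 ^ suc k) ≡ F (2 ^ k) +ℚ F (2 ^ k) +ℚ φ (2 ^ k) (2 ^ k)
F-2^suc k = F-window k (2^n+2^n≡2^[1+n] k) (2^k≢6 (suc k)) (m≤m+n (2 ^ k) _) (m<m+n (2 ^ k) (m^n>0 2 k))

-- Each doubling adds φ (2^k) (2^k) to 2 F (2^k), and this is 2^k times the next term of the series.
F-2^ : ∀ k → F (2 ^ k) +ℚ F (2 ^ k) ≡ (2 ^ k) /2^ 0 *ℚ S k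
F-2^ zero = trans (/2^-+ 0 0 1) (trans (0/2^ 1) (sym (ℚₚ.*-zeroʳ (1 /2^ 0))))
F-2^ (suc k) = begin
  F (2 ^ suc k) +ℚ F (2 ^ suc k)
    ≡⟨ cong (λ x → x +ℚ x) (trans (F-2^suc k) (cong (_+ℚ φ (2 ^ k) (2 ^ k)) (F-2^ k))) ⟩
  (c *ℚ S k +ℚ φ (2 ^ k) (2 ^ k)) +ℚ (c *ℚ S k +ℚ φ (2 ^ k) (2 ^ k))
    ≡⟨ cong (λ x → (c *ℚ S k +ℚ x) +ℚ (c *ℚ S k +ℚ x)) (trans (cong ((2 ^ k * 2 ^ k) /2^_) (2^n+2^n≡2^[1+n] k)) (sym (/2^0-*/2^ (2 ^ k) (2 ^ k) (2 ^ suc k)))) ⟩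
  (c *ℚ S k +ℚ c *ℚ t) +ℚ (c *ℚ S k +ℚ c *ℚ t)
    ≡⟨ eq c (S k) t ⟩
  (c +ℚ c) *ℚ (S k +ℚ t)
    ≡⟨ cong₂ _*ℚ_ (trans (/2^-+ (2 ^ k) (2 ^ k) 0) (cong (_/2^ 0) (2^n+2^n≡2^[1+n] k))) (sym (S-suc k)) ⟩
  (2 ^ suc k) /2^ 0 *ℚ S (suc k)  ∎
  where
  open ≡-Reasoning
  c = (2 ^ k) /2^ 0
  t = 2 ^ k /2^ (2 ^ suc k)
  eq : ∀ c s t → (c *ℚ s +ℚ c *ℚ t) +ℚ (c *ℚ s +ℚ c *ℚ t) ≡ (c +ℚ c) *ℚ (s +ℚ t)
  eq = RS.solve-∀ ℚ-ring

ratio-F : ∀ {m} → 1 ≤ m → m /2^ 0 *ℚ ratio (H m) m ≡ F m +ℚ F m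
ratio-F {suc n} _ = trans (/2^0-* (suc n) (H (suc n)) (suc n * 2 ^ n)) (trans
  (/-≡ (suc n * H (suc n)) (H (suc n) + H (suc n)) (suc n * 2 ^ n) (2 ^ suc n) (eq (suc n) (H (suc n)) (2 ^ n)))
  (trans (sym (/2^-/ (H (suc n) + H (suc n)) (suc n))) (sym (/2^-+ (H (suc n)) (H (suc n)) (suc n)))))
  where
  instance
    denominator≢0 : NonZero (suc n * 2 ^ n)
    denominator≢0 = m*n≢0 (suc n) (2 ^ n) {{_}} {{m^n≢0 2 n}}
    2^≢0 : NonZero (2 ^ suc n)
    2^≢0 = m^n≢0 2 (suc n)
  eq : ∀ m h x → m * h * (2 * x) ≡ (h + h) * (m * x)
  eq = solve-∀

≤-from-scaled : ∀ {m c D x} .{{_ : NonZero D}} → 1 ≤ m → c * D ≤ m → m /2^ 0 *ℚ x ≤ℚ c /2^ 0 → x ≤ℚ (+ 1 / D)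
≤-from-scaled {m} {c} {D} {x} 1≤m cD≤m mx≤c = ℚₚ.*-cancelˡ-≤-pos (m /2^ 0) {{/2^0-positive 1≤m}}
  (ℚₚ.≤-trans mx≤c (ℚₚ.≤-trans (/2^0≤/ c (m * 1) D (≤-trans cD≤m (≤-reflexive (sym (*-identityʳ m))))) (ℚₚ.≤-reflexive (sym (/2^0-* m 1 D)))))

-- Divide m = r + t * 2^K. Then 2 F m ≥ 2 t F (2^K) = t * 2^K * S K, so m (S K - ratio) ≤ r * S K ≤
-- 2^K, as S K ≤ 1.
S-≤-ratio : ∀ {m D} K .{{_ : NonZero D}} → 1 ≤ m → 2 ^ K * D ≤ m → S K - ratio (H m) m ≤ℚ (+ 1 / D)
S-≤-ratio {m} {D} K 1≤m KD≤m = ≤-from-scaled {m} {2 ^ K} {D} 1≤m KD≤m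
  (lin (m /2^ 0) (ratio (H m) m) (F m) (S K) (t /2^ 0) (F x) (x /2^ 0) (r /2^ 0) (t /2^ 0 *ℚ F x)
    (ratio-F 1≤m) (F-2^ K) refl
    (trans (cong (_/2^ 0) (m≡m%n+[m/n]*n m x)) (trans (sym (/2^-+ r (t * x) 0)) (cong (r /2^ 0 +ℚ_) (sym (/2^0-*/2^ t x 0)))))
    (ℚₚ.≤-trans (ℚₚ.≤-reflexive (/2^0-*/2^ t (H x) x)) (F-multiple t (m^n>0 2 K) (m/n*n≤m m x)))
    r*S≤x)
  where
  x = 2 ^ K
  instance
    x≢0 : NonZero x
    x≢0 = m^n≢0 2 K
  t = m div x
  r = m % x
  S≤1 : S K ≤ℚ 1 /2^ 0
  S≤1 = subst (λ k → S k ≤ℚ 1 /2^ 0) (+-identityʳ K) (ℚₚ.≤-trans (S-≤ 0 K) (ℚₚ.≤-reflexive (ℚₚ.+-identityˡ (1 /2^ 0))))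
  r*S≤x : r /2^ 0 *ℚ S K ≤ℚ x /2^ 0
  r*S≤x = ℚₚ.≤-trans (ℚₚ.*-monoˡ-≤-nonNeg (r /2^ 0) {{nonNegative (/2^-nonneg r 0)}} S≤1)
    (ℚₚ.≤-trans (ℚₚ.≤-reflexive (/2^0-*/2^ r 1 0)) (/2^-mono 0 (≤-trans (≤-reflexive (*-identityʳ r)) (<⇒≤ (m%n<n m x)))))
  lin : ∀ m ρ f s t fx x r w → m *ℚ ρ ≡ f +ℚ f → fx +ℚ fx ≡ x *ℚ s → w ≡ t *ℚ fx → m ≡ r +ℚ t *ℚ x → w ≤ℚ f → r *ℚ s ≤ℚ x →
    m *ℚ (s - ρ) ≤ℚ x
  lin m ρ f s t fx x r w e₁ e₂ e₃ e₄ w≤f rs≤x = linℚ (ℚₚ.+-mono-≤ (ℚₚ.+-mono-≤ w≤f w≤f) rs≤x) (begin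
    m *ℚ (s - ρ) +ℚ (f +ℚ f +ℚ x)                        ≡⟨ eq₁ m s ρ f x ⟩
    m *ℚ s +ℚ (f +ℚ f) +ℚ x +ℚ (-ℚ (m *ℚ ρ))             ≡⟨ cong₂ (λ a b → a *ℚ s +ℚ (f +ℚ f) +ℚ x +ℚ (-ℚ b)) e₄ e₁ ⟩
    (r +ℚ t *ℚ x) *ℚ s +ℚ (f +ℚ f) +ℚ x +ℚ (-ℚ (f +ℚ f))  ≡⟨ eq₂ r t x s f ⟩
    x +ℚ (t *ℚ (x *ℚ s) +ℚ r *ℚ s)                       ≡⟨ cong (λ a → x +ℚ (t *ℚ a +ℚ r *ℚ s)) e₂ ⟨
    x +ℚ (t *ℚ (fx +ℚ fx) +ℚ r *ℚ s)                     ≡⟨ cong (λ a → x +ℚ (a +ℚ r *ℚ s)) (ℚₚ.*-distribˡ-+ t fx fx) ⟩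
    x +ℚ (t *ℚ fx +ℚ t *ℚ fx +ℚ r *ℚ s)                  ≡⟨ cong (λ a → x +ℚ (a +ℚ a +ℚ r *ℚ s)) e₃ ⟨
    x +ℚ (w +ℚ w +ℚ r *ℚ s)                              ∎)
    where
    open ≡-Reasoning
    eq₁ : ∀ m s ρ f x → m *ℚ (s - ρ) +ℚ (f +ℚ f +ℚ x) ≡ m *ℚ s +ℚ (f +ℚ f) +ℚ x +ℚ (-ℚ (m *ℚ ρ))
    eq₁ = RS.solve-∀ ℚ-ring
    eq₂ : ∀ r t x s f → (r +ℚ t *ℚ x) *ℚ s +ℚ (f +ℚ f) +ℚ x +ℚ (-ℚ (f +ℚ f)) ≡ x +ℚ (t *ℚ (x *ℚ s) +ℚ r *ℚ s)
    eq₂ = RS.solve-∀ ℚ-ring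

ratio-nonneg : ∀ h m → 0ℚ ≤ℚ ratio h m
ratio-nonneg h zero = ℚₚ.≤-refl
ratio-nonneg h (suc n) = /-mono-≤ 0 h 1 (suc n * 2 ^ n) {{_}} {{m*n≢0 (suc n) (2 ^ n) {{_}} {{m^n≢0 2 n}}}} z≤n

-- Divide 2^L = r + t * m instead. Then 2^L * S L = 2 F (2^L) ≥ 2 t F m = t * m * ratio, so 2^L
-- (ratio - S L) ≤ r * ratio ≤ 2 F m ≤ 2 H m. The last bound is crude but independent of L, which
-- may be taken as large as m requires.
ratio-≤-S : ∀ {m D} L .{{_ : NonZero D}} → 1 ≤ m → (H m + H m) * D ≤ 2 ^ L → ratio (H m) m - S L ≤ℚ (+ 1 / D)
ratio-≤-S {m} {D} L 1≤m BD≤ = ≤-from-scaled {2 ^ L} {H m + H m} {D} (m^n>0 2 L) BD≤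
  (lin (m /2^ 0) (ratio (H m) m) (F m) (S L) (t /2^ 0) (F (2 ^ L)) (2 ^ L /2^ 0) (r /2^ 0) (t /2^ 0 *ℚ F m) ((H m + H m) /2^ 0)
    (ratio-F 1≤m) (F-2^ L) refl
    (trans (cong (_/2^ 0) (m≡m%n+[m/n]*n (2 ^ L) m)) (trans (sym (/2^-+ r (t * m) 0)) (cong (r /2^ 0 +ℚ_) (sym (/2^0-*/2^ t m 0)))))
    (ℚₚ.≤-trans (ℚₚ.≤-reflexive (/2^0-*/2^ t (H m) m)) (F-multiple t 1≤m (m/n*n≤m (2 ^ L) m)))
    (ℚₚ.*-monoʳ-≤-nonNeg (ratio (H m) m) {{nonNegative (ratio-nonneg (H m) m)}} (/2^-mono 0 (<⇒≤ (m%n<n (2 ^ L) m))))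
    (ℚₚ.≤-trans (ℚₚ.+-mono-≤ F≤H F≤H) (ℚₚ.≤-reflexive (/2^-+ (H m) (H m) 0))))
  where
  instance
    m≢0 : NonZero m
    m≢0 = >-nonZero 1≤m
  t = 2 ^ L div m
  r = 2 ^ L % m
  F≤H : F m ≤ℚ H m /2^ 0
  F≤H = ≤-via-/2^ m refl (/2^-shift (H m) 0 m refl) (m≤m*n (H m) (2 ^ m) {{m^n≢0 2 m}})
  lin : ∀ m ρ f s t fx x r w B → m *ℚ ρ ≡ f +ℚ f → fx +ℚ fx ≡ x *ℚ s → w ≡ t *ℚ f → x ≡ r +ℚ t *ℚ m → w ≤ℚ fx → r *ℚ ρ ≤ℚ m *ℚ ρ → f +ℚ f ≤ℚ B →
    x *ℚ (ρ - s) ≤ℚ B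
  lin m ρ f s t fx x r w B e₁ e₂ e₃ e₄ w≤fx rρ≤mρ 2f≤B = linℚ (ℚₚ.+-mono-≤ (ℚₚ.+-mono-≤ w≤fx w≤fx) (ℚₚ.+-mono-≤ rρ≤mρ 2f≤B)) (begin
    x *ℚ (ρ - s) +ℚ (fx +ℚ fx +ℚ (m *ℚ ρ +ℚ B))                 ≡⟨ cong (λ a → x *ℚ (ρ - s) +ℚ (a +ℚ (m *ℚ ρ +ℚ B))) e₂ ⟩
    x *ℚ (ρ - s) +ℚ (x *ℚ s +ℚ (m *ℚ ρ +ℚ B))                   ≡⟨ eq₁ x ρ s m B ⟩
    x *ℚ ρ +ℚ m *ℚ ρ +ℚ B                                       ≡⟨ cong₂ (λ a b → a *ℚ ρ +ℚ b +ℚ B) e₄ e₁ ⟩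
    (r +ℚ t *ℚ m) *ℚ ρ +ℚ (f +ℚ f) +ℚ B                         ≡⟨ eq₂ r t m ρ f B ⟩
    B +ℚ (t *ℚ (m *ℚ ρ) +ℚ (r *ℚ ρ +ℚ (f +ℚ f)))                ≡⟨ cong (λ a → B +ℚ (t *ℚ a +ℚ (r *ℚ ρ +ℚ (f +ℚ f)))) e₁ ⟩
    B +ℚ (t *ℚ (f +ℚ f) +ℚ (r *ℚ ρ +ℚ (f +ℚ f)))                ≡⟨ cong (λ a → B +ℚ (a +ℚ (r *ℚ ρ +ℚ (f +ℚ f)))) (ℚₚ.*-distribˡ-+ t f f) ⟩
    B +ℚ (t *ℚ f +ℚ t *ℚ f +ℚ (r *ℚ ρ +ℚ (f +ℚ f)))             ≡⟨ cong (λ a → B +ℚ (a +ℚ a +ℚ (r *ℚ ρ +ℚ (f +ℚ f)))) e₃ ⟨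
    B +ℚ (w +ℚ w +ℚ (r *ℚ ρ +ℚ (f +ℚ f)))                       ∎)
    where
    open ≡-Reasoning
    eq₁ : ∀ x ρ s m B → x *ℚ (ρ - s) +ℚ (x *ℚ s +ℚ (m *ℚ ρ +ℚ B)) ≡ x *ℚ ρ +ℚ m *ℚ ρ +ℚ B
    eq₁ = RS.solve-∀ ℚ-ring
    eq₂ : ∀ r t m ρ f B → (r +ℚ t *ℚ m) *ℚ ρ +ℚ (f +ℚ f) +ℚ B ≡ B +ℚ (t *ℚ (m *ℚ ρ) +ℚ (r *ℚ ρ +ℚ (f +ℚ f)))
    eq₂ = RS.solve-∀ ℚ-ring

∣∣-≤ : ∀ {x e} → x ≤ℚ e → -ℚ x ≤ℚ e → ∣ x ∣ ≤ℚ e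
∣∣-≤ {x} x≤e -x≤e with ℚₚ.∣p∣≡p∨∣p∣≡-p x
... | inj₁ eq = ℚₚ.≤-trans (ℚₚ.≤-reflexive eq) x≤e
... | inj₂ eq = ℚₚ.≤-trans (ℚₚ.≤-reflexive eq) -x≤e

ratio-near-S : ∀ {m D K} J .{{_ : NonZero D}} → 1 ≤ m → D ≤ 2 ^ K → 2 ^ K * D ≤ m → K ≤ J → ∣ ratio (H m) m - S J ∣ ≤ℚ (+ 1 / D) +ℚ (+ 1 / D)
ratio-near-S {m} {D} {K} J 1≤m D≤2^K KD≤m K≤J with J ∸ K | m∸n+n≡m K≤J
... | d | refl = ∣∣-≤
  (upper (ratio (H m) m) (S (d + K)) (S K) (S (B + K)) (1 /2^ K) (+ 1 / D) (ratio-≤-S (B + K) 1≤m BD≤) (S-≤ K B) (S-mono K d) 1/2^K≤)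
  (lower (ratio (H m) m) (S (d + K)) (S K) (1 /2^ K) (+ 1 / D) (S-≤-ratio K 1≤m KD≤m) (S-≤ K d) 1/2^K≤)
  where
  B = H m + H m
  -- The choice L = B + K gives B ≤ 2^B and D ≤ 2^K as separate factors, and keeps S L within 1 /
  -- 2^K of S K although L depends on m.
  BD≤ : B * D ≤ 2 ^ (B + K)
  BD≤ = ≤-trans (*-mono-≤ (≤-trans (n≤1+n B) (n<2^n B)) D≤2^K) (≤-reflexive (sym (^-distribˡ-+-* 2 B K)))
  1/2^K≤ : 1 /2^ K ≤ℚ (+ 1 / D)
  1/2^K≤ = ℚₚ.≤-trans (ℚₚ.≤-reflexive (/2^-/ 1 K)) (/-mono-≤ 1 1 (2 ^ K) D {{m^n≢0 2 K}} (*-monoʳ-≤ 1 D≤2^K))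
  upper : ∀ ρ sJ sK sL δ e → ρ - sL ≤ℚ e → sL ≤ℚ sK +ℚ δ → sK ≤ℚ sJ → δ ≤ℚ e → ρ - sJ ≤ℚ e +ℚ e
  upper ρ sJ sK sL δ e e₁ e₂ e₃ e₄ = linℚ (ℚₚ.+-mono-≤ (ℚₚ.+-mono-≤ e₁ e₂) (ℚₚ.+-mono-≤ e₃ e₄)) (RS.solve (ρ ∷ sJ ∷ sK ∷ sL ∷ δ ∷ e ∷ []) ℚ-ring)
  lower : ∀ ρ sJ sK δ e → sK - ρ ≤ℚ e → sJ ≤ℚ sK +ℚ δ → δ ≤ℚ e → -ℚ (ρ - sJ) ≤ℚ e +ℚ e
  lower ρ sJ sK δ e e₁ e₂ e₃ = linℚ (ℚₚ.+-mono-≤ (ℚₚ.+-mono-≤ e₁ e₂) e₃) (RS.solve (ρ ∷ sJ ∷ sK ∷ δ ∷ e ∷ []) ℚ-ring)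

-- Convergence to the sum of the series is expressed within ℚ by letting m and the length J of the
-- partial sum grow independently of each other.
ratio-tends : ∀ n → Σ ℕ λ N → Σ ℕ λ J₀ → ∀ m J h → N ≤ m → J₀ ≤ J → IsH2 m h → ∣ ratio h m - S J ∣ <ℚ (+ 1 / suc n)
ratio-tends n = 2 ^ K * D , K , near
  where
  -- With this D the bound 2 / D is half of 1 / suc n, which makes the inequality strict. The two
  -- extra units in K match the factor 4.
  D = 4 * suc n
  K = 2 + suc n
  D≤2^K : D ≤ 2 ^ K
  D≤2^K = ≤-trans (*-monoʳ-≤ 4 (≤-trans (n≤1+n (suc n)) (n<2^n (suc n)))) (≤-reflexive (eq (2 ^ suc n)))
    where
    eq : ∀ x → 4 * x ≡ 2 * (2 * x)
    eq = solve-∀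
  2/D< : (+ 1 / D) +ℚ (+ 1 / D) <ℚ (+ 1 / suc n)
  2/D< = ℚₚ.≤-<-trans (ℚₚ.≤-reflexive (/-+ 1 1 D)) (/-mono-< 2 1 D (suc n) (linℕ (n + n + 1) (≤-refl {0}) (eq n)))
    where
    eq : ∀ n → suc (2 * suc n) + 0 + (n + n + 1) ≡ 1 * (4 * suc n) + 0
    eq = solve-∀
  near : ∀ m J h → 2 ^ K * D ≤ m → K ≤ J → IsH2 m h → ∣ ratio h m - S J ∣ <ℚ (+ 1 / suc n)
  near m J h N≤m K≤J isH2 = subst (λ h → ∣ ratio h m - S J ∣ <ℚ (+ 1 / suc n)) (sym (IsH2-unique 1≤m isH2))
    (ℚₚ.≤-<-trans (ratio-near-S {D = D} {K} J 1≤m D≤2^K N≤m K≤J) 2/D<)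
    where
    1≤m : 1 ≤ m
    1≤m = ≤-trans (*-mono-≤ (m^n>0 2 K) (s≤s (z≤n {n + 3 * suc n}))) N≤m

theorem1p9 : ((m k : ℕ) → 3 ≤ m → m ≢ 6 → 2 ^ k + 2 ^ (k ∸ 1) ≤ m → m < 2 ^ k + 2 ^ (suc k) →
    Σ ℕ λ h → Σ ℕ λ a → Σ ℕ λ b →
    IsH2 m h × IsH2 (2 ^ k) a × IsH2 (m ∸ 2 ^ k) b ×
    h ≡ a * 2 ^ (m ∸ 2 ^ k) + b * 2 ^ (2 ^ k) + 2 ^ k * (m ∸ 2 ^ k))
    × (Σ ℕ λ h → Σ ℕ λ c → IsH2 6 h × IsH2 3 c × h ≡ 2 * c * 2 ^ 3 + 9)
    × ((n : ℕ) → Σ ℕ λ N → Σ ℕ λ J₀ → (m J h : ℕ) → N ≤ m → J₀ ≤ J → IsH2 m h →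
    ∣ ratio h m - S J ∣ <ℚ (+ 1 / suc n))
theorem1p9 = recursion , (H 6 , H 3 , IsH2-H (s≤s z≤n) , IsH2-H (s≤s z≤n) , refl) , ratio-tends
  where
  recursion : (m k : ℕ) → 3 ≤ m → m ≢ 6 → 2 ^ k + 2 ^ (k ∸ 1) ≤ m → m < 2 ^ k + 2 ^ (suc k) →
    Σ ℕ λ h → Σ ℕ λ a → Σ ℕ λ b → IsH2 m h × IsH2 (2 ^ k) a × IsH2 (m ∸ 2 ^ k) b ×
    h ≡ a * 2 ^ (m ∸ 2 ^ k) + b * 2 ^ (2 ^ k) + 2 ^ k * (m ∸ 2 ^ k)
  -- For k = 0 truncated subtraction reads the lower bound as 2 ≤ m, and m < 3 contradicts 3 ≤ m.
  recursion m zero 3≤m _ _ m<3 = ⊥-elim (<⇒≱ m<3 3≤m)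
  recursion m (suc k) 3≤m m≢6 lo up = H m , H (2 ^ suc k) , H (m ∸ 2 ^ suc k) ,
    IsH2-H (≤-trans (s≤s z≤n) 3≤m) , IsH2-H (m^n>0 2 (suc k)) ,
    IsH2-H (m<n⇒0<n∸m (<-≤-trans (m<m+n (2 ^ suc k) (m^n>0 2 k)) lo)) ,
    H-window {m} {suc k} m≢6 (window (linℕ 0 (*-monoʳ-≤ 2 lo) (eq (2 ^ k) m)) up)
    where
    eq : ∀ x m → 3 * (2 * x) + 2 * m + 0 ≡ 2 * m + 2 * (2 * x + x)
    eq = solve-∀
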